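{- Let $p$ be a prime, let $n>0$ be an integer, and let $f_1,f_2\in\mathbb{F}_p[X]$ be distinct monic irreducible polynomials of degree $n$. Then inverse chaining with respect to $(f_1,f_2)$ induces a unique partition of $\mathcal{P}(p,n)\setminus\{0,1,\ldots,p-1\}$ into cycles of even length $\ge 4$. That is, there is a unique partition of $\mathcal{P}(p,n)\setminus\{0,1,\ldots,p-1\}$ into (undirected) cycles such that for every $a\in\mathcal{P}(p,n)\setminus\{0,1,\ldots,p-1\}$ the inverse chain of $a$ with respect to $(f_1,f_2)$ is a traversal of the cycle containing $a$, and every cycle in this partition has even length at least $4$.
   Context: $\mathbb{F}_p=\mathbb{Z}/p\mathbb{Z}$. $\mathcal{P}(p,n)$ denotes the set of all polynomials in $\mathbb{F}_p[X]$ of degree at most $n-1$ (including $0$); $\{0,1,\ldots,p-1\}$ denotes the set of constant polynomials, identified with $\mathbb{F}_p$. For a monic irreducible polynomial $f\in\mathbb{F}_p[X]$ of degree $n$ and a non-zero $a\in\mathcal{P}(p,n)$, $\mathrm{inv}_f(a)\in\mathcal{P}(p,n)$ denotes the multiplicative inverse of $a$ with respect to $f$: the unique polynomial of degree at most $n-1$ with $a\cdot \mathrm{inv}_f(a)\equiv 1 \pmod{f}$. For an integer $k>0$ and a non-zero $a\in\mathcal{P}(p,n)$, the $k$-chain of $a$ with respect to $(f_1,f_2)$ is the sequence $(a_0,a_1,\ldots,a_k)$ defined by $a_0=a$, $a_i=\mathrm{inv}_{f_1}(a_{i-1})$ if $i$ is odd, and $a_i=\mathrm{inv}_{f_2}(a_{i-1})$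 if $i\ge 2$ is even. For non-constant $a$, the inverse chain of $a$ with respect to $(f_1,f_2)$ is the $k$-chain $(a_0,\ldots,a_k)$ with $k>0$ even, $a_k=a_0=a$, and $a_0,\ldots,a_{k-1}$ all distinct; it is viewed as a cycle of length $k$ on the vertices $a_0,\ldots,a_{k-1}$, with consecutive elements joined by edges (including the edge between $a_{k-1}$ and $a_0$). -}

module Defs where

open import Algebra.Bundles using (RawRing)
import Algebra.Definitions.RawSemiring as RawSemiringDefs
open import Data.Fin.Base using (Fin; zero; suc; toℕ; fromℕ; inject₁)
open import Data.List.Base using (List; []; _∷_; map; lookup)
import Data.List.Membership.Setoid as SetoidMembership
open import Data.Nat.Base as ℕ using (ℕ; zero; suc; _<_; _≤_; _∸_; NonZero)
open import Data.Nat.DivMod using (_mod_)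
import Data.Nat.Divisibility as ℕ∣
open import Data.Product using (∃; ∃!; _×_)
open import Data.Sum.Base using (_⊎_)
open import Data.Vec.Base using (Vec; toList)
open import Function.Base using (_∘_)
open import Function.Bundles using (_⇔_)
open import Function.Definitions using (Injective)
import Function.Properties.Equivalence as ⇔
open import Level using (Level; 0ℓ; _⊔_)
open import Relation.Binary.Bundles using (Setoid)
open import Relation.Binary.PropositionalEquality.Core using (_≡_)
open import Relation.Nullary.Negation.Core using (¬_)
open import Relation.Unary using (Pred)

module Polynomial {c ℓ : Level} (R : RawRing c ℓ) where

  private module R = RawRing R

  -- Coefficient lists, constant term first.  Trailing zeros are allowed;
  -- _≈_ below identifies lists that differ only in those.
  Poly : Set c
  Poly = List R.Carrier

  coeff : Poly → ℕ → R.Carrier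
  coeff []      _       = R.0#
  coeff (a ∷ f) zero    = a
  coeff (a ∷ f) (suc m) = coeff f m

  infix 4 _≈_
  record _≈_ (f g : Poly) : Set ℓ where
    constructor mk≈
    field
      coeff-≈ : ∀ m → coeff f m R.≈ coeff g m

  infixl 6 _+_
  _+_ : Poly → Poly → Poly
  []      + g       = g
  (a ∷ f) + []      = a ∷ f
  (a ∷ f) + (b ∷ g) = (a R.+ b) ∷ (f + g)

  infixl 7 _*_
  _*_ : Poly → Poly → Poly
  []      * g = []
  (a ∷ f) * g = map (a R.*_) g + (R.0# ∷ (f * g))

  -_ : Poly → Poly
  -_ = map (R.-_)

  const : R.Carrier → Poly
  const a = a ∷ []

  polyRawRing : RawRing c ℓ
  polyRawRing = record
    { Carrier = Poly
    ; _≈_     = _≈_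
    ; _+_     = _+_
    ; _*_     = _*_
    ; -_      = -_
    ; 0#      = []
    ; 1#      = const R.1#
    }

  open RawSemiringDefs (RawRing.rawSemiring polyRawRing) public
    using (_∣_; Irreducible)

  infix 4 _≡_[mod_]
  _≡_[mod_] : Poly → Poly → Poly → Set (c ⊔ ℓ)
  g ≡ h [mod f ] = f ∣ g + (- h)

  record MonicOfDegree (n : ℕ) (f : Poly) : Set ℓ where
    field
      leading : coeff f n R.≈ R.1#
      above   : ∀ m → n < m → coeff f m R.≈ R.0#

𝔽 : (p : ℕ) .{{_ : NonZero p}} → RawRing 0ℓ 0ℓ
𝔽 p = record
  { Carrier = Fin p
  ; _≈_     = _≡_
  ; _+_     = λ a b → (toℕ a ℕ.+ toℕ b) mod p
  ; _*_     = λ a b → (toℕ a ℕ.* toℕ b) mod p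
  ; -_      = λ a → (p ∸ toℕ a) mod p
  ; 0#      = 0 mod p
  ; 1#      = 1 mod p
  }

-- A cycle is presented by a closed walk v₀, …, v_len = v₀ with
-- v₀, …, v_{len-1} distinct.  Different walks (rotations, reflections)
-- may present the same undirected cycle; see _≅_.  The degenerate
-- lengths 1 and 2 are not excluded.
record Cycle (V : Set) : Set where
  field
    len      : ℕ
    walk     : Fin (suc len) → V
    len>0    : 0 < len
    closed   : walk (fromℕ len) ≡ walk zero
    distinct : Injective _≡_ _≡_ (walk ∘ inject₁)

module _ {V : Set} where

  open Cycle

  infix 4 _∈ᵛ_
  _∈ᵛ_ : V → Cycle V → Set
  v ∈ᵛ C = ∃ λ (i : Fin (len C)) → walk C (inject₁ i) ≡ v

  Edge : Cycle V → V → V → Set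
  Edge C u v = ∃ λ (i : Fin (len C)) →
      (walk C (inject₁ i) ≡ u × walk C (suc i) ≡ v)
    ⊎ (walk C (inject₁ i) ≡ v × walk C (suc i) ≡ u)

  -- Equality of undirected cycles: same vertices and same edges.
  infix 4 _≅_
  record _≅_ (C D : Cycle V) : Set where
    field
      vertices : ∀ v → v ∈ᵛ C ⇔ v ∈ᵛ D
      edges    : ∀ u v → Edge C u v ⇔ Edge D u v

  open _≅_

  cycleSetoid : Setoid 0ℓ 0ℓ
  cycleSetoid = record
    { Carrier       = Cycle V
    ; _≈_           = _≅_
    ; isEquivalence = record
      { refl  = record
        { vertices = λ _ → ⇔.refl
        ; edges    = λ _ _ → ⇔.refl
        }
      ; sym   = λ e → record
        { vertices = λ v → ⇔.sym (vertices e v)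
        ; edges    = λ u v → ⇔.sym (edges e u v)
        }
      ; trans = λ e e′ → record
        { vertices = λ v → ⇔.trans (vertices e v) (vertices e′ v)
        ; edges    = λ u v → ⇔.trans (edges e u v) (edges e′ u v)
        }
      }
    }

  open SetoidMembership cycleSetoid using (_∈_)

  record IsPartition (S : Pred V 0ℓ) (Cs : List (Cycle V)) : Set where
    field
      within : ∀ i v → v ∈ᵛ lookup Cs i → S v
      covers : ∀ v → S v → ∃! _≡_ λ i → v ∈ᵛ lookup Cs i

  -- Equality as sets of undirected cycles.
  infix 4 _≋_
  _≋_ : List (Cycle V) → List (Cycle V) → Set
  Cs ≋ Ds = ∀ C → C ∈ Cs ⇔ C ∈ Ds

EvenLength≥4 : ∀ {V} → Cycle V → Set
EvenLength≥4 C = 2 ℕ∣.∣ len × 4 ≤ len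
  where open Cycle C

module InverseChaining (p : ℕ) .{{_ : NonZero p}} where

  open RawRing (𝔽 p) public using () renaming (Carrier to 𝔽ₚ)
  open Polynomial (𝔽 p) public

  -- Polynomials of degree at most n - 1, by their n coefficients.
  𝒫 : ℕ → Set
  𝒫 n = Vec 𝔽ₚ n

  module _ {n : ℕ} where

    ⟦_⟧ : 𝒫 n → Poly
    ⟦_⟧ = toList

    NonConstant : Pred (𝒫 n) 0ℓ
    NonConstant a = ¬ ∃ λ (c : 𝔽ₚ) → ⟦ a ⟧ ≈ const c

    -- b = inv_f(a): b is the unique element of 𝒫 n with a b ≡ 1 (mod f).
    IsInverse : Poly → 𝒫 n → 𝒫 n → Set
    IsInverse f a b = Inverts b × (∀ c → Inverts c → b ≡ c)
      where
      Inverts : 𝒫 n → Set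
      Inverts x = ⟦ a ⟧ * ⟦ x ⟧ ≡ const (1 mod p) [mod f ]

    record IsChain (f₁ f₂ : Poly) (a : 𝒫 n) (k : ℕ)
                   (as : Fin (suc k) → 𝒫 n) : Set where
      field
        start : as zero ≡ a
        odd   : ∀ (i : Fin k) → 2 ℕ∣.∤ toℕ (suc i) →
                IsInverse f₁ (as (inject₁ i)) (as (suc i))
        even  : ∀ (i : Fin k) → 2 ℕ∣.∣ toℕ (suc i) →
                IsInverse f₂ (as (inject₁ i)) (as (suc i))

    -- That k > 0, a_k = a₀ and a₀, …, a_{k-1} are distinct is part of
    -- the walk being a Cycle.
    record IsInverseChain (f₁ f₂ : Poly) (a : 𝒫 n) (C : Cycle (𝒫 n)) : Set where
      open Cycle C
      field
        even-len : 2 ℕ∣.∣ len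
        isChain  : IsChain f₁ f₂ a len walk

    -- The inverse chain of a, a cyclic walk itself, traverses a cycle
    -- exactly when it presents that same undirected cycle.
    record IsInducedPartition (f₁ f₂ : Poly) (Cs : List (Cycle (𝒫 n))) : Set where
      field
        isPartition : IsPartition NonConstant Cs
        hasChain    : ∀ a → NonConstant a → ∃ λ C → IsInverseChain f₁ f₂ a C
        traverses   : ∀ a → NonConstant a → ∀ C → IsInverseChain f₁ f₂ a C →
                      ∀ i → a ∈ᵛ lookup Cs i → C ≅ lookup Cs i

{-# OPTIONS --safe #-}
module Submission where

-- Inversion modulo an irreducible polynomial f of degree n is an involution on the
-- nonzero polynomials of degree less than n (inverse), and it preserves the set S of
-- nonconstant ones (inverse-const⇒const).  On S it has no fixed point: if a² = 1
-- modulo f, then f divides (a - 1)(a + 1), so a is 1 or -1 (self-inverse⇒const).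
-- Inversions modulo f₁ and f₂ agree nowhere on S: if a b = 1 modulo both, then the
-- coprime f₁ and f₂ both divide a b - 1, whose degree is below 2 n, so a b = 1 and a
-- is constant (common-inverse⇒const).
--
-- Hence the two inversions are two disjoint perfect matchings of the finite set S
-- (matchings).  The rest is combinatorics of two such matchings.  The walk from a
-- vertex that applies them alternately returns to its start after an even number of
-- steps, by the pigeonhole principle (period); up to the first such return it does
-- not repeat a vertex, since a repetition at an even distance would give an earlier
-- return (orbit-rewind), and one at an odd distance would lead, walking inwards from
-- both ends, to a fixed point (orbit-odd).  Its length is not 2, since the matchings
-- are disjoint (alternating⇒EvenLength≥4).  At each vertex of the
-- resulting cycle the two edges lead to its two partners (edges-at), so that a cycle
-- is determined by any one of its vertices (common-vertex⇒≅).  Collecting such cycles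
-- until all of S is covered gives the partition.
--
-- Uniqueness is formal: in any induced partition, each cycle is the one traversed by
-- the inverse chain of any of its vertices (induced-⊆).

open import Defs
open import Algebra.Bundles using (CommutativeMonoid; CommutativeRing)
import Algebra.Definitions.RawSemiring as RawSemiringDefs
open import Data.Fin.Base using (Fin; zero; suc; toℕ; fromℕ; inject₁; funToFin; finToFun)
open import Data.Fin.Induction using (<-weakInduction)
open import Data.Fin.Properties as Finₚ
  using ( any?; finToFun-funToFin; pigeonhole; toℕ<n; toℕ-fromℕ; toℕ-fromℕ<; toℕ-inject₁
        ; toℕ-injective)
open import Data.Fin.Relation.Unary.Top using (view; ‵fromℕ; ‵inject₁)
open import Data.List.Base using (List; []; _∷_; allFin; lookup; map)
open import Data.List.Membership.Propositional using (_∈_)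
open import Data.List.Membership.Propositional.Properties using (∈-allFin; ∈-lookup; ∈-map⁺)
open import Data.List.Relation.Unary.All as All using (All; []; _∷_)
open import Data.List.Relation.Unary.AllPairs using (AllPairs; []; _∷_)
open import Data.List.Relation.Unary.Any as Any using (Any; here; there; index)
open import Data.List.Relation.Unary.Any.Properties using (lookup-index)
open import Data.Nat.Base as ℕ using (ℕ; zero; suc; _≤_; _<_; _∸_; z≤n; s≤s; NonZero)
open import Data.Nat.Coprimality using (prime⇒coprime; coprime-Bézout)
open import Data.Nat.Divisibility as ℕ∣ using (_∣?_; divides)
open import Data.Nat.DivMod
  using (_mod_; _%_; m<n⇒m%n≡m; m%n<n; %-distribˡ-+; %-distribˡ-*; m*n%n≡0)
open import Data.Nat.GCD using (module Bézout)
open import Data.Nat.Primality using (Prime; prime⇒nonTrivial)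
import Data.Nat.Properties as ℕₚ
open import Data.Product.Base using (∃; ∃₂; _×_; _,_; proj₁; proj₂)
open import Data.Sum.Base using (_⊎_; inj₁; inj₂; [_,_]′)
open import Data.Vec.Base as Vec using ([]; _∷_; tabulate)
open import Data.Vec.Properties using (≡-dec; tabulate-cong; tabulate∘lookup)
open import Function.Base using (_∘_)
open import Function.Bundles using (mk⇔)
open import Level using (Level; 0ℓ; _⊔_)
open import Relation.Binary.Bundles using (Setoid)
open import Relation.Binary.Definitions
  using (DecidableEquality; tri<; tri≈; tri>) renaming (Decidable to DecidableRelation)
import Relation.Binary.PropositionalEquality as ≡
import Relation.Binary.Reasoning.Setoid as SetoidReasoning
open import Relation.Binary.Structures using (IsEquivalence)
open import Relation.Nullary using (Dec; yes; no; contradiction; ¬?)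
open import Relation.Nullary.Decidable.Core using (map′; _×-dec_)
open import Relation.Nullary.Negation.Core using (¬_)
open import Relation.Unary using (Pred) renaming (Decidable to DecidablePred)

-- The ring of polynomials over a commutative ring

module PolynomialRing {c ℓ : Level} (K : CommutativeRing c ℓ) where

  private module K = CommutativeRing K
  open import Algebra.Properties.Ring K.ring using (-0#≈0#)
  open Polynomial K.rawRing public
  open _≈_ public

  -- Multiplication of a polynomial by a scalar.
  infixr 8 _·_
  _·_ : K.Carrier → Poly → Poly
  a · f = map (a K.*_) f

  coeff-+ : ∀ f g m → coeff (f + g) m K.≈ coeff f m K.+ coeff g m
  coeff-+ []      g       m       = K.sym (K.+-identityˡ _)
  coeff-+ (a ∷ f) []      m       = K.sym (K.+-identityʳ _)
  coeff-+ (a ∷ f) (b ∷ g) zero    = K.refl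
  coeff-+ (a ∷ f) (b ∷ g) (suc m) = coeff-+ f g m

  coeff-· : ∀ a f m → coeff (a · f) m K.≈ a K.* coeff f m
  coeff-· a []      m       = K.sym (K.zeroʳ a)
  coeff-· a (b ∷ f) zero    = K.refl
  coeff-· a (b ∷ f) (suc m) = coeff-· a f m

  coeff-‿- : ∀ f m → coeff (- f) m K.≈ K.- coeff f m
  coeff-‿- []      m       = K.sym -0#≈0#
  coeff-‿- (a ∷ f) zero    = K.refl
  coeff-‿- (a ∷ f) (suc m) = coeff-‿- f m

  ≈-isEquivalence : IsEquivalence _≈_
  ≈-isEquivalence = record
    { refl  = mk≈ λ _ → K.refl
    ; sym   = λ e → mk≈ λ m → K.sym (coeff-≈ e m)
    ; trans = λ e e′ → mk≈ λ m → K.trans (coeff-≈ e m) (coeff-≈ e′ m)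
    }

  +-commutativeMonoid : CommutativeMonoid c ℓ
  +-commutativeMonoid = record
    { Carrier = Poly ; _≈_ = _≈_ ; _∙_ = _+_ ; ε = []
    ; isCommutativeMonoid = record
      { isMonoid = record
        { isSemigroup = record
          { isMagma = record
            { isEquivalence = ≈-isEquivalence
            ; ∙-cong = λ {f} {f′} {g} {g′} e e′ → mk≈ λ m →
                K.trans (coeff-+ f g m)
                  (K.trans (K.+-cong (coeff-≈ e m) (coeff-≈ e′ m))
                    (K.sym (coeff-+ f′ g′ m)))
            }
          ; assoc = λ f g h → mk≈ λ m →
              K.trans (K.trans (coeff-+ (f + g) h m) (K.+-congʳ (coeff-+ f g m)))
                (K.trans (K.+-assoc _ _ _)
                  (K.sym (K.trans (coeff-+ f (g + h) m) (K.+-congˡ (coeff-+ g h m)))))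
          }
        ; identity = (λ f → mk≈ λ _ → K.refl)
                   , (λ f → mk≈ λ m → K.trans (coeff-+ f [] m) (K.+-identityʳ _))
        }
      ; comm = λ f g → mk≈ λ m →
          K.trans (coeff-+ f g m) (K.trans (K.+-comm _ _) (K.sym (coeff-+ g f m)))
      }
    }

  private
    module + = CommutativeMonoid +-commutativeMonoid
    open import Algebra.Properties.CommutativeSemigroup +.commutativeSemigroup
      using (interchange; x∙yz≈y∙xz)
    open SetoidReasoning +.setoid

  ∷-cong : ∀ {a b f g} → a K.≈ b → f ≈ g → (a ∷ f) ≈ (b ∷ g)
  ∷-cong e e′ = mk≈ λ { zero → e ; (suc m) → coeff-≈ e′ m }

  ∷≈[] : ∀ {a f} → a K.≈ K.0# → f ≈ [] → (a ∷ f) ≈ []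
  ∷≈[] e e′ = mk≈ λ { zero → e ; (suc m) → coeff-≈ e′ m }

  ∷≈[]⁻¹ : ∀ {a f} → (a ∷ f) ≈ [] → a K.≈ K.0# × f ≈ []
  ∷≈[]⁻¹ e = coeff-≈ e zero , mk≈ λ m → coeff-≈ e (suc m)

  ·-cong : ∀ {a b f g} → a K.≈ b → f ≈ g → a · f ≈ b · g
  ·-cong {f = f} {g} e e′ = mk≈ λ m →
    K.trans (coeff-· _ f m) (K.trans (K.*-cong e (coeff-≈ e′ m)) (K.sym (coeff-· _ g m)))

  ·-zero : ∀ {a} f → a K.≈ K.0# → a · f ≈ []
  ·-zero f e = mk≈ λ m →
    K.trans (coeff-· _ f m) (K.trans (K.*-congʳ e) (K.zeroˡ _))

  ·-distribˡ : ∀ a f g → a · (f + g) ≈ a · f + a · g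
  ·-distribˡ a f g = mk≈ λ m →
    K.trans (coeff-· a (f + g) m) (K.trans (K.*-congˡ (coeff-+ f g m))
      (K.trans (K.distribˡ _ _ _)
        (K.sym (K.trans (coeff-+ (a · f) (a · g) m)
          (K.+-cong (coeff-· a f m) (coeff-· a g m))))))

  ·-distribʳ : ∀ a b f → (a K.+ b) · f ≈ a · f + b · f
  ·-distribʳ a b f = mk≈ λ m →
    K.trans (coeff-· _ f m) (K.trans (K.distribʳ _ _ _)
      (K.sym (K.trans (coeff-+ (a · f) (b · f) m)
        (K.+-cong (coeff-· a f m) (coeff-· b f m)))))

  ·-assoc : ∀ a b f → (a K.* b) · f ≈ a · b · f
  ·-assoc a b f = mk≈ λ m →
    K.trans (coeff-· _ f m) (K.trans (K.*-assoc _ _ _)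
      (K.sym (K.trans (coeff-· a (b · f) m) (K.*-congˡ (coeff-· b f m)))))

  ·-identity : ∀ f → K.1# · f ≈ f
  ·-identity f = mk≈ λ m → K.trans (coeff-· _ f m) (K.*-identityˡ _)

  -- Multiplication by the indeterminate prepends a zero.
  0∷-+ : ∀ f g → K.0# ∷ (f + g) ≈ (K.0# ∷ f) + (K.0# ∷ g)
  0∷-+ f g = ∷-cong (K.sym (K.+-identityˡ _)) +.refl

  0∷-* : ∀ f g → (K.0# ∷ f) * g ≈ K.0# ∷ (f * g)
  0∷-* f g = +.∙-congʳ (·-zero g K.refl)

  ·-0∷ : ∀ a f → a · (K.0# ∷ f) ≈ K.0# ∷ (a · f)
  ·-0∷ a f = ∷-cong (K.zeroʳ a) +.refl

  *-zeroʳ : ∀ f → f * [] ≈ []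
  *-zeroʳ []      = +.refl
  *-zeroʳ (a ∷ f) = ∷≈[] K.refl (*-zeroʳ f)

  *-zeroˡ : ∀ {f} g → f ≈ [] → f * g ≈ []
  *-zeroˡ {[]}    g e = +.refl
  *-zeroˡ {a ∷ f} g e with a≈0 , f≈[] ← ∷≈[]⁻¹ e =
    +.∙-cong (·-zero g a≈0) (∷≈[] K.refl (*-zeroˡ g f≈[]))

  *-congˡ : ∀ f {g g′} → g ≈ g′ → f * g ≈ f * g′
  *-congˡ []      e = +.refl
  *-congˡ (a ∷ f) e = +.∙-cong (·-cong K.refl e) (∷-cong K.refl (*-congˡ f e))

  *-congʳ : ∀ {f f′} g → f ≈ f′ → f * g ≈ f′ * g
  *-congʳ {[]}             g e = +.sym (*-zeroˡ g (+.sym e))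
  *-congʳ {a ∷ f} {[]}     g e = *-zeroˡ g e
  *-congʳ {a ∷ f} {b ∷ f′} g e = +.∙-cong (·-cong (coeff-≈ e zero) +.refl)
    (∷-cong K.refl (*-congʳ {f} {f′} g (mk≈ λ m → coeff-≈ e (suc m))))

  *-∷ : ∀ f b g → f * (b ∷ g) ≈ b · f + (K.0# ∷ f * g)
  *-∷ []      b g = +.sym (∷≈[] K.refl +.refl)
  *-∷ (a ∷ f) b g = ∷-cong (K.+-congʳ (K.*-comm a b)) (begin
    a · g + f * (b ∷ g)               ≈⟨ +.∙-congˡ (*-∷ f b g) ⟩
    a · g + (b · f + (K.0# ∷ f * g))  ≈⟨ x∙yz≈y∙xz (a · g) (b · f) _ ⟩
    b · f + (a · g + (K.0# ∷ f * g))  ∎)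

  *-comm : ∀ f g → f * g ≈ g * f
  *-comm []      g = +.sym (*-zeroʳ g)
  *-comm (a ∷ f) g = begin
    a · g + (K.0# ∷ f * g)  ≈⟨ +.∙-congˡ (∷-cong K.refl (*-comm f g)) ⟩
    a · g + (K.0# ∷ g * f)  ≈⟨ *-∷ g a f ⟨
    g * (a ∷ f)             ∎

  *-distribʳ : ∀ h f g → (f + g) * h ≈ f * h + g * h
  *-distribʳ h []      g       = +.refl
  *-distribʳ h (a ∷ f) []      = +.sym (+.identityʳ _)
  *-distribʳ h (a ∷ f) (b ∷ g) = begin
    (a K.+ b) · h + (K.0# ∷ (f + g) * h)
      ≈⟨ +.∙-cong (·-distribʳ a b h)
           (+.trans (∷-cong K.refl (*-distribʳ h f g)) (0∷-+ (f * h) (g * h))) ⟩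
    (a · h + b · h) + ((K.0# ∷ f * h) + (K.0# ∷ g * h))
      ≈⟨ interchange (a · h) (b · h) _ _ ⟩
    (a ∷ f) * h + (b ∷ g) * h
      ∎

  ·-*-assoc : ∀ a f g → (a · f) * g ≈ a · (f * g)
  ·-*-assoc a []      g = +.refl
  ·-*-assoc a (b ∷ f) g = begin
    (a K.* b) · g + (K.0# ∷ (a · f) * g)
      ≈⟨ +.∙-cong (·-assoc a b g) (∷-cong K.refl (·-*-assoc a f g)) ⟩
    a · b · g + (K.0# ∷ a · (f * g))
      ≈⟨ +.∙-congˡ (·-0∷ a (f * g)) ⟨
    a · b · g + a · (K.0# ∷ f * g)
      ≈⟨ ·-distribˡ a (b · g) _ ⟨
    a · (b · g + (K.0# ∷ f * g))
      ∎

  *-assoc : ∀ f g h → (f * g) * h ≈ f * (g * h)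
  *-assoc []      g h = +.refl
  *-assoc (a ∷ f) g h = begin
    (a · g + (K.0# ∷ f * g)) * h
      ≈⟨ *-distribʳ h (a · g) _ ⟩
    (a · g) * h + (K.0# ∷ f * g) * h
      ≈⟨ +.∙-cong (·-*-assoc a g h)
           (+.trans (0∷-* (f * g) h) (∷-cong K.refl (*-assoc f g h))) ⟩
    a · (g * h) + (K.0# ∷ f * (g * h))
      ∎

  const-* : ∀ a f → const a * f ≈ a · f
  const-* a f = +.trans (+.∙-congˡ (∷≈[] K.refl +.refl)) (+.identityʳ _)

  polyRing : CommutativeRing c ℓ
  polyRing = record
    { Carrier = Poly ; _≈_ = _≈_ ; _+_ = _+_ ; _*_ = _*_ ; -_ = -_
    ; 0# = [] ; 1# = const K.1#
    ; isCommutativeRing = record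
      { isRing = record
        { +-isAbelianGroup = record
          { isGroup = record
            { isMonoid = +.isMonoid
            ; inverse  = comm∧invʳ⇒inv +.comm neg-inverseʳ
            ; ⁻¹-cong  = λ {f} {g} e → mk≈ λ m → K.trans (coeff-‿- f m)
                (K.trans (K.-‿cong (coeff-≈ e m)) (K.sym (coeff-‿- g m)))
            }
          ; comm = +.comm
          }
        ; *-cong     = λ {f} {f′} {g} e e′ → +.trans (*-congʳ g e) (*-congˡ f′ e′)
        ; *-assoc    = *-assoc
        ; *-identity = comm∧idˡ⇒id *-comm λ f → +.trans (const-* K.1# f) (·-identity f)
        ; distrib    = comm∧distrʳ⇒distr +.∙-cong *-comm *-distribʳ
        }
      ; *-comm = *-comm
      }
    }
    where
    open import Algebra.Consequences.Setoid +.setoid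
      using (comm∧invʳ⇒inv; comm∧idˡ⇒id; comm∧distrʳ⇒distr)
    neg-inverseʳ : ∀ f → f + (- f) ≈ []
    neg-inverseʳ f = mk≈ λ m → K.trans (coeff-+ f (- f) m)
      (K.trans (K.+-congˡ (coeff-‿- f m)) (K.-‿inverseʳ _))

-- Quotient rings

-- The quotient of a commutative ring by the principal ideal of f: the same
-- carrier, with congruence modulo f as its equality.  The congruence is a record,
-- so that its two sides can be inferred.
module Quotient {c ℓ : Level} (P : CommutativeRing c ℓ) (f : CommutativeRing.Carrier P) where

  open CommutativeRing P
  open import Algebra.Properties.Semiring.Divisibility semiring
    using (_∣_; _,_; ∣ʳ-respʳ-≈; x∣ʳyx; ∣ʳ-trans; _∣0)
  open import Algebra.Properties.Ring ring
    using ( -‿distribˡ-*; [y-z]x≈yx-zx; x[y-z]≈xy-xz; x≈y⇒x∙y⁻¹≈ε; -0#≈0#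
          ; ⁻¹-anti-homo‿-)
  open import Algebra.Properties.AbelianGroup +-abelianGroup using (⁻¹-∙-comm)
  open import Algebra.Properties.CommutativeSemigroup +-commutativeSemigroup
    using (interchange)
  open SetoidReasoning setoid

  infix 4 _≡ᶠ_
  record _≡ᶠ_ (x y : Carrier) : Set (c ⊔ ℓ) where
    constructor mk≡
    field
      ∣-difference : f ∣ x - y
  open _≡ᶠ_ public

  ∣-+ : ∀ {x y} → f ∣ x → f ∣ y → f ∣ x + y
  ∣-+ (q , e) (q′ , e′) = q + q′ , trans (distribʳ _ _ _) (+-cong e e′)

  ∣-‿- : ∀ {x} → f ∣ x → f ∣ - x
  ∣-‿- (q , e) = - q , trans (sym (-‿distribˡ-* _ _)) (-‿cong e)

  ≈⇒≡ᶠ : ∀ {x y} → x ≈ y → x ≡ᶠ y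
  ≈⇒≡ᶠ e = mk≡ (∣ʳ-respʳ-≈ (sym (x≈y⇒x∙y⁻¹≈ε e)) (f ∣0))

  ∣⇒≡0 : ∀ {x} → f ∣ x → x ≡ᶠ 0#
  ∣⇒≡0 {x} f∣x = mk≡ (∣ʳ-respʳ-≈ (sym (trans (+-congˡ -0#≈0#) (+-identityʳ x))) f∣x)

  telescope : ∀ x y z → (x - y) + (y - z) ≈ x - z
  telescope x y z = begin
    (x - y) + (y - z)    ≈⟨ +-assoc _ _ _ ⟩
    x + (- y + (y - z))  ≈⟨ +-congˡ (+-assoc _ _ _) ⟨
    x + ((- y + y) - z)  ≈⟨ +-congˡ (+-congʳ (-‿inverseˡ y)) ⟩
    x + (0# - z)         ≈⟨ +-congˡ (+-identityˡ _) ⟩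
    x - z                ∎

  quotientRing : CommutativeRing c (c ⊔ ℓ)
  quotientRing = record
    { Carrier = Carrier ; _≈_ = _≡ᶠ_ ; _+_ = _+_ ; _*_ = _*_ ; -_ = -_
    ; 0# = 0# ; 1# = 1#
    ; isCommutativeRing = record
      { isRing = record
        { +-isAbelianGroup = record
          { isGroup = record
            { isMonoid = record
              { isSemigroup = record
                { isMagma = record
                  { isEquivalence = record
                    { refl  = ≈⇒≡ᶠ refl
                    ; sym   = λ {x} {y} (mk≡ e) → mk≡ (∣ʳ-respʳ-≈ (⁻¹-anti-homo‿- x y) (∣-‿- e))
                    ; trans = λ {x} {y} {z} (mk≡ e) (mk≡ e′) →
                        mk≡ (∣ʳ-respʳ-≈ (telescope x y z) (∣-+ e e′))
                    }
                  ; ∙-cong = λ {x} {x′} {y} {y′} (mk≡ e) (mk≡ e′) → mk≡ (∣ʳ-respʳ-≈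
                      (trans (interchange x (- x′) y (- y′)) (+-congˡ (⁻¹-∙-comm x′ y′)))
                      (∣-+ e e′))
                  }
                ; assoc = λ x y z → ≈⇒≡ᶠ (+-assoc x y z)
                }
              ; identity = (λ x → ≈⇒≡ᶠ (+-identityˡ x)) , (λ x → ≈⇒≡ᶠ (+-identityʳ x))
              }
            ; inverse = (λ x → ≈⇒≡ᶠ (-‿inverseˡ x)) , (λ x → ≈⇒≡ᶠ (-‿inverseʳ x))
            ; ⁻¹-cong = λ {x} {y} (mk≡ e) →
                mk≡ (∣ʳ-respʳ-≈ (sym (⁻¹-∙-comm x (- y))) (∣-‿- e))
            }
          ; comm = λ x y → ≈⇒≡ᶠ (+-comm x y)
          }
        ; *-cong = λ {x} {x′} {y} {y′} (mk≡ e) (mk≡ e′) → mk≡ (∣ʳ-respʳ-≈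
            (telescope (x * y) (x′ * y) (x′ * y′))
            (∣-+ (∣ʳ-respʳ-≈ (trans (*-comm y _) ([y-z]x≈yx-zx y x x′)) (∣ʳ-trans e (x∣ʳyx _ y)))
                 (∣ʳ-respʳ-≈ (x[y-z]≈xy-xz x′ y y′) (∣ʳ-trans e′ (x∣ʳyx _ x′)))))
        ; *-assoc    = λ x y z → ≈⇒≡ᶠ (*-assoc x y z)
        ; *-identity = (λ x → ≈⇒≡ᶠ (*-identityˡ x)) , (λ x → ≈⇒≡ᶠ (*-identityʳ x))
        ; distrib    = (λ x y z → ≈⇒≡ᶠ (distribˡ x y z)) , (λ x y z → ≈⇒≡ᶠ (distribʳ x y z))
        }
      ; *-comm = λ x y → ≈⇒≡ᶠ (*-comm x y)
      }
    }

open ≡ using (_≡_; refl; sym; trans; cong; cong₂; subst; subst₂; module ≡-Reasoning)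

-- Degrees and division by monic polynomials

module MonicDivision {κ ℓ : Level} (K : CommutativeRing κ ℓ) where

  private module K = CommutativeRing K
  open import Algebra.Properties.Ring K.ring using (-0#≈0#)
  open PolynomialRing K
  open MonicOfDegree
  private
    module P = CommutativeRing polyRing
    open import Algebra.Properties.AbelianGroup P.+-abelianGroup using (xyx⁻¹≈y)
    open import Algebra.Properties.Semiring.Divisibility P.semiring using (_,_)

  -- The polynomials of degree less than k, zero included.
  record Below (k : ℕ) (f : Poly) : Set ℓ where
    constructor below
    field
      vanish : ∀ m → k ≤ m → coeff f m K.≈ K.0#
  open Below public

  Below-≈ : ∀ {k f g} → f ≈ g → Below k f → Below k g
  Below-≈ e f<k = below λ m k≤m → K.trans (K.sym (coeff-≈ e m)) (vanish f<k m k≤m)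

  Below-≤ : ∀ {k l f} → k ≤ l → Below k f → Below l f
  Below-≤ k≤l f<k = below λ m l≤m → vanish f<k m (ℕₚ.≤-trans k≤l l≤m)

  Below-+ : ∀ {k f g} → Below k f → Below k g → Below k (f + g)
  Below-+ {f = f} {g} f<k g<k = below λ m k≤m → K.trans (coeff-+ f g m)
    (K.trans (K.+-cong (vanish f<k m k≤m) (vanish g<k m k≤m)) (K.+-identityˡ _))

  Below-‿- : ∀ {k f} → Below k f → Below k (- f)
  Below-‿- {f = f} f<k = below λ m k≤m →
    K.trans (coeff-‿- f m) (K.trans (K.-‿cong (vanish f<k m k≤m)) -0#≈0#)

  Below-0 : ∀ {f} → Below 0 f → f ≈ []
  Below-0 f<0 = mk≈ λ m → vanish f<0 m z≤n

  Below-[] : ∀ {k f} → f ≈ [] → Below k f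
  Below-[] e = below λ m _ → coeff-≈ e m

  Below-∷ : ∀ {k a f} → Below k f → Below (suc k) (a ∷ f)
  Below-∷ f<k = below λ { (suc m) (s≤s k≤m) → vanish f<k m k≤m }

  Below-tail : ∀ {k a f} → Below (suc k) (a ∷ f) → Below k f
  Below-tail f<k = below λ m k≤m → vanish f<k (suc m) (s≤s k≤m)

  Below-const : ∀ a → Below 1 (const a)
  Below-const a = Below-∷ (Below-[] P.refl)

  Below-1⇒const : ∀ {f} → Below 1 f → f ≈ const (coeff f 0)
  Below-1⇒const f<1 = mk≈ λ { zero → K.refl ; (suc m) → vanish f<1 (suc m) (s≤s z≤n) }

  Below-pred : ∀ {k f} → Below (suc k) f → coeff f k K.≈ K.0# → Below k f
  Below-pred {k} {f} f≤k e = below go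
    where
    go : ∀ m → k ≤ m → coeff f m K.≈ K.0#
    go m k≤m with ℕₚ.m≤n⇒m<n∨m≡n k≤m
    ... | inj₁ k<m  = vanish f≤k m k<m
    ... | inj₂ refl = e

  Below-· : ∀ {k f} a → Below k f → Below k (a · f)
  Below-· {f = f} a f<k = below λ m k≤m →
    K.trans (coeff-· a f m) (K.trans (K.*-congˡ (vanish f<k m k≤m)) (K.zeroʳ a))

  Below-* : ∀ {k l} f g → Below k f → Below l g → Below (k ℕ.+ l) (f * g)
  Below-* {zero}      f       g f<k g<l = Below-[] (*-zeroˡ g (Below-0 f<k))
  Below-* {suc k}     []      g f<k g<l = Below-[] P.refl
  Below-* {suc k} {l} (a ∷ f) g f<k g<l = Below-+
    (Below-· a (Below-≤ (ℕₚ.m≤n+m l (suc k)) g<l))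
    (Below-∷ (Below-* f g (Below-tail f<k) g<l))

  monic⇒Below : ∀ {n f} → MonicOfDegree n f → Below (suc n) f
  monic⇒Below f-monic = below (above f-monic)

  -- Above the degree of a monic f, the term a f of (a + X q) f does not contribute.
  coeff-*-suc : ∀ {n f} → MonicOfDegree n f → ∀ a q m → n ≤ m →
                coeff ((a ∷ q) * f) (suc m) K.≈ coeff (q * f) m
  coeff-*-suc {n} {f} f-monic a q m n≤m = begin
    coeff ((a ∷ q) * f) (suc m)                    ≈⟨ coeff-+ (a · f) _ (suc m) ⟩
    coeff (a · f) (suc m) K.+ coeff (q * f) m      ≈⟨ K.+-congʳ (coeff-· a f (suc m)) ⟩
    a K.* coeff f (suc m) K.+ coeff (q * f) m
      ≈⟨ K.+-congʳ (K.*-congˡ (above f-monic (suc m) (s≤s n≤m))) ⟩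
    a K.* K.0# K.+ coeff (q * f) m                 ≈⟨ K.+-congʳ (K.zeroʳ a) ⟩
    K.0# K.+ coeff (q * f) m                       ≈⟨ K.+-identityˡ _ ⟩
    coeff (q * f) m                                ∎
    where open SetoidReasoning K.setoid

  -- A monic factor of degree n contributes n to the degree of a product.
  monic-cofactor : ∀ {n f} → MonicOfDegree n f → ∀ k q → Below (n ℕ.+ k) (q * f) → Below k q
  monic-cofactor f-monic k [] qf<n+k = Below-[] P.refl
  monic-cofactor {n} f-monic (suc k) (a ∷ q) qf<n+k =
    Below-∷ (monic-cofactor f-monic k q (below λ m n+k≤m → K.trans
      (K.sym (coeff-*-suc f-monic a q m (ℕₚ.≤-trans (ℕₚ.m≤m+n n k) n+k≤m)))
      (vanish qf<n+k (suc m) (ℕₚ.≤-trans (ℕₚ.≤-reflexive (ℕₚ.+-suc n k)) (s≤s n+k≤m)))))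
  monic-cofactor {n} {f} f-monic zero (a ∷ q) qf<n = Below-[] (∷≈[] a≈0 q≈0)
    where
    open SetoidReasoning K.setoid
    q≈0 : q ≈ []
    q≈0 = Below-0 (monic-cofactor f-monic zero q (below λ m n+0≤m → K.trans
      (K.sym (coeff-*-suc f-monic a q m (ℕₚ.≤-trans (ℕₚ.m≤m+n n 0) n+0≤m)))
      (vanish qf<n (suc m) (ℕₚ.m≤n⇒m≤1+n n+0≤m))))
    -- As the tail q vanishes, a is the coefficient of degree n of the product.
    a≈0 : a K.≈ K.0#
    a≈0 = begin
      a                          ≈⟨ K.*-identityʳ a ⟨
      a K.* K.1#                 ≈⟨ K.*-congˡ (leading f-monic) ⟨
      a K.* coeff f n            ≈⟨ coeff-· a f n ⟨
      coeff (a · f) n            ≈⟨ coeff-≈ a·f≈ n ⟩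
      coeff ((a ∷ q) * f) n      ≈⟨ vanish qf<n n (ℕₚ.≤-reflexive (ℕₚ.+-identityʳ n)) ⟩
      K.0#                       ∎
      where
      a·f≈ : a · f ≈ (a ∷ q) * f
      a·f≈ = P.trans (P.sym (P.+-identityʳ _))
        (P.+-congˡ (P.sym (∷≈[] K.refl (*-zeroˡ f q≈0))))

  monic-∣⇒≈0 : ∀ {n f g} → MonicOfDegree n f → f ∣ g → Below n g → g ≈ []
  monic-∣⇒≈0 {n} {f} f-monic (q , qf≈g) g<n = P.trans (P.sym qf≈g)
    (*-zeroˡ {q} f (Below-0 (monic-cofactor f-monic 0 q
      (Below-≈ (P.sym qf≈g) (Below-≤ (ℕₚ.m≤m+n n 0) g<n)))))

  -- Long division, one coefficient at a time: if g = q f + r, then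
  -- a + X g = (c + X q) f + (a + X r - c f), where c is the coefficient of
  -- degree n of a + X r.
  divide : ∀ {n f} → MonicOfDegree n f → ∀ g → ∃₂ λ q r → g ≈ q * f + r × Below n r
  divide f-monic []      = [] , [] , P.refl , Below-[] P.refl
  divide {n} {f} f-monic (a ∷ g) with q , r , g≈qf+r , r<n ← divide f-monic g =
    (c ∷ q) , r′ , P.sym expand , Below-pred r′≤n leading≈0
    where
    c = coeff (a ∷ r) n
    r′ = (a ∷ r) + (- (c · f))
    coeff-r′ : ∀ m → coeff r′ m K.≈ coeff (a ∷ r) m K.+ K.- (c K.* coeff f m)
    coeff-r′ m = K.trans (coeff-+ (a ∷ r) (- (c · f)) m) (K.+-congˡ
      (K.trans (coeff-‿- (c · f) m) (K.-‿cong (coeff-· c f m))))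
    r′≤n : Below (suc n) r′
    r′≤n = Below-+ (Below-∷ r<n) (Below-‿- (Below-· c (monic⇒Below f-monic)))
    leading≈0 : coeff r′ n K.≈ K.0#
    leading≈0 = begin
      coeff r′ n                        ≈⟨ coeff-r′ n ⟩
      c K.+ K.- (c K.* coeff f n)       ≈⟨ K.+-congˡ (K.-‿cong
        (K.trans (K.*-congˡ (leading f-monic)) (K.*-identityʳ c))) ⟩
      c K.+ K.- c                       ≈⟨ K.-‿inverseʳ c ⟩
      K.0#                              ∎
      where open SetoidReasoning K.setoid
    expand : (c ∷ q) * f + r′ ≈ a ∷ g
    expand = begin
      (c · f + (K.0# ∷ q * f)) + ((a ∷ r) + (- (c · f)))
        ≈⟨ P.+-assoc (c · f + (K.0# ∷ q * f)) (a ∷ r) _ ⟨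
      (c · f + (K.0# ∷ q * f)) + (a ∷ r) + (- (c · f))
        ≈⟨ P.+-congʳ (P.+-assoc (c · f) (K.0# ∷ q * f) (a ∷ r)) ⟩
      c · f + ((K.0# ∷ q * f) + (a ∷ r)) + (- (c · f))
        ≈⟨ xyx⁻¹≈y (c · f) _ ⟩
      (K.0# ∷ q * f) + (a ∷ r)
        ≈⟨ ∷-cong (K.+-identityˡ a) (P.sym g≈qf+r) ⟩
      a ∷ g
        ∎
      where open SetoidReasoning P.setoid

-- Residue fields of polynomials over a field

-- Polynomials over a field: a nontrivial commutative ring with decidable equality
-- in which every nonzero element has an inverse.
module FieldPolynomials {κ ℓ : Level} (K : CommutativeRing κ ℓ)
  (_≟_ : DecidableRelation (CommutativeRing._≈_ K))
  (1≉0 : ¬ CommutativeRing._≈_ K (CommutativeRing.1# K) (CommutativeRing.0# K))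
  (invertible : ∀ a → ¬ CommutativeRing._≈_ K a (CommutativeRing.0# K) →
    ∃ λ b → CommutativeRing._≈_ K (CommutativeRing._*_ K b a) (CommutativeRing.1# K))
  where

  private module K = CommutativeRing K
  open PolynomialRing K
  open MonicDivision K
  open MonicOfDegree
  private module P = CommutativeRing polyRing
  open import Algebra.Properties.Semiring.Divisibility P.semiring using (_,_)

  ≈[]? : ∀ f → Dec (f ≈ [])
  ≈[]? []      = yes P.refl
  ≈[]? (a ∷ f) = map′ (λ (e , e′) → ∷≈[] e e′) ∷≈[]⁻¹ ((a ≟ K.0#) ×-dec ≈[]? f)

  _≈?_ : ∀ f g → Dec (f ≈ g)
  f ≈? g = map′ (x∙y⁻¹≈ε⇒x≈y f g) x≈y⇒x∙y⁻¹≈ε (≈[]? (f + (- g)))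
    where open import Algebra.Properties.Group P.+-group using (x∙y⁻¹≈ε⇒x≈y; x≈y⇒x∙y⁻¹≈ε)

  -- Every polynomial with leading coefficient in degree d has a monic multiple.
  normalise : ∀ {d a} → Below (suc d) a → ¬ coeff a d K.≈ K.0# →
              ∃ λ u → MonicOfDegree d (const u * a)
  normalise {d} {a} a≤d a_d≉0 with u , ua_d≈1 ← invertible (coeff a d) a_d≉0 =
    u , record
      { leading = K.trans (coeff-u*a d) ua_d≈1
      ; above   = λ m d<m → K.trans (coeff-u*a m)
          (K.trans (K.*-congˡ (vanish a≤d m d<m)) (K.zeroʳ u))
      }
    where
    coeff-u*a : ∀ m → coeff (const u * a) m K.≈ u K.* coeff a m
    coeff-u*a m = K.trans (coeff-≈ (const-* u a) m) (coeff-· u a m)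

  degree : ∀ {a} → ¬ a ≈ [] → ∃ λ d → Below (suc d) a × ¬ coeff a d K.≈ K.0#
  degree {[]}    a≉0 = contradiction P.refl a≉0
  degree {c ∷ a} a≉0 with ≈[]? a
  ... | yes a≈0 = 0 , Below-∷ (Below-[] a≈0) , λ c≈0 → a≉0 (∷≈[] c≈0 a≈0)
  ... | no a≉0′ with d , a≤d , a_d≉0 ← degree a≉0′ =
    suc d , Below-∷ a≤d , a_d≉0

  -- A divisor of a nonzero constant is constant.
  const-factor : ∀ {a b c} → ¬ c K.≈ K.0# → a * b ≈ const c → Below 1 a
  const-factor {a} {b} {c} c≉0 ab≈c
    with d , b≤d , b_d≉0 ← degree {b} (λ b≈0 →
           c≉0 (coeff-≈ (P.trans (P.sym ab≈c) (P.trans (*-congˡ a b≈0) (*-zeroʳ a))) 0))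
    with u , ub-monic ← normalise b≤d b_d≉0 =
    monic-cofactor ub-monic 1 a
      (Below-≤ (ℕₚ.m≤n+m 1 d) (Below-≈ (P.sym a*ub≈) (Below-const (u K.* c))))
    where
    open SetoidReasoning P.setoid
    open import Algebra.Properties.CommutativeSemigroup P.*-commutativeSemigroup using (x∙yz≈y∙xz)
    a*ub≈ : a * (const u * b) ≈ const (u K.* c)
    a*ub≈ = begin
      a * (const u * b)  ≈⟨ x∙yz≈y∙xz a (const u) b ⟩
      const u * (a * b)  ≈⟨ *-congˡ (const u) ab≈c ⟩
      const u * const c  ≈⟨ const-* u (const c) ⟩
      const (u K.* c)    ∎

  module Modulo {n : ℕ} {f : Poly} (f-monic : MonicOfDegree n f) where

    open Quotient polyRing f
    private module Q = CommutativeRing quotientRing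
    open import Algebra.Properties.Ring Q.ring using (-‿distribʳ-*)
    open import Algebra.Properties.Group Q.+-group using (inverseʳ-unique)
    open import Algebra.Properties.CommutativeSemigroup Q.*-commutativeSemigroup
      using (x∙yz≈y∙xz)
    open import Algebra.Properties.Group P.+-group using () renaming (x∙y⁻¹≈ε⇒x≈y to x-y≈0⇒x≈y)
    open SetoidReasoning Q.setoid

    -- Polynomials of degree less than n represent distinct residue classes.
    ≡ᶠ⇒≈ : ∀ {a b} → Below n a → Below n b → a ≡ᶠ b → a ≈ b
    ≡ᶠ⇒≈ {a} {b} a<n b<n (mk≡ f∣a-b) =
      x-y≈0⇒x≈y a b (monic-∣⇒≈0 f-monic f∣a-b (Below-+ a<n (Below-‿- b<n)))

    *-inverse-unique : ∀ a {b c} → a * b ≡ᶠ P.1# → a * c ≡ᶠ P.1# → b ≡ᶠ c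
    *-inverse-unique a {b} {c} ab≡1 ac≡1 = begin
      b            ≈⟨ Q.*-identityʳ b ⟨
      b * P.1#     ≈⟨ Q.*-congˡ {b} ac≡1 ⟨
      b * (a * c)  ≈⟨ x∙yz≈y∙xz b a c ⟩
      a * (b * c)  ≈⟨ Q.*-assoc a b c ⟨
      a * b * c    ≈⟨ Q.*-congʳ ab≡1 ⟩
      P.1# * c     ≈⟨ Q.*-identityˡ c ⟩
      c            ∎

    -- An invertible residue is not a zero divisor.
    cancel : ∀ a {b c} → a * b ≡ᶠ P.1# → a * c ≡ᶠ [] → c ≡ᶠ []
    cancel a {b} {c} ab≡1 ac≡0 = begin
      c            ≈⟨ Q.*-identityˡ c ⟨
      P.1# * c     ≈⟨ Q.*-congʳ ab≡1 ⟨
      a * b * c    ≈⟨ Q.*-congʳ (Q.*-comm a b) ⟩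
      b * a * c    ≈⟨ Q.*-assoc b a c ⟩
      b * (a * c)  ≈⟨ Q.*-congˡ {b} ac≡0 ⟩
      b * []       ≈⟨ Q.zeroʳ b ⟩
      []           ∎

    remainder : ∀ g → ∃ λ r → Below n r × g ≡ᶠ r
    remainder g with q , r , g≈qf+r , r<n ← divide f-monic g = r , r<n , (begin
      g          ≈⟨ ≈⇒≡ᶠ g≈qf+r ⟩
      q * f + r  ≈⟨ Q.+-congʳ (∣⇒≡0 (q , P.refl)) ⟩
      [] + r     ∎)

    -- A nonzero residue a is invertible.  Let d be its degree and g = u a its monic
    -- multiple.  Write f = q g + r with r of degree less than d.  If r is zero, then q
    -- or g is a unit, as f is irreducible; a unit q would make g a multiple of f, whose
    -- degree is larger.  Otherwise r has an inverse by induction, and r is a multiple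
    -- of a modulo f.
    inverse : Irreducible f → ∀ {a} → Below n a → ¬ a ≈ [] → ∃ λ b → a * b ≡ᶠ P.1#
    inverse f-irr {a} a<n a≉0 = go n a<n a<n a≉0
      where
      open RawSemiringDefs.Irreducible f-irr using (split-∣1)
      go : ∀ d {a} → Below d a → Below n a → ¬ a ≈ [] → ∃ λ b → a * b ≡ᶠ P.1#
      go zero    a<0 a<n a≉0 = contradiction (Below-0 a<0) a≉0
      go (suc d) {a} a≤d a<n a≉0 with coeff a d ≟ K.0#
      ... | yes a_d≈0 = go d (Below-pred a≤d a_d≈0) a<n a≉0
      ... | no  a_d≉0
        with u , g-monic ← normalise a≤d a_d≉0
        with q , r , f≈qg+r , r<d ← divide g-monic f
        with ≈[]? r
      ... | no r≉0 = (w * s) , (begin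
          a * (w * s)  ≈⟨ Q.*-assoc a w s ⟨
          a * w * s    ≈⟨ Q.*-congʳ r≡aw ⟨
          r * s        ≈⟨ rs≡1 ⟩
          P.1#         ∎)
        where
        d≤n : d ≤ n
        d≤n with ℕₚ.≤-total d n
        ... | inj₁ d≤n = d≤n
        ... | inj₂ n≤d = contradiction (vanish a<n d n≤d) a_d≉0
        IH = go d r<d (Below-≤ d≤n r<d) r≉0
        s = proj₁ IH
        rs≡1 = proj₂ IH
        w = - (q * const u)
        qg+r≡0 : q * (const u * a) + r ≡ᶠ []
        qg+r≡0 = begin
          q * (const u * a) + r  ≈⟨ ≈⇒≡ᶠ f≈qg+r ⟨
          f                      ≈⟨ ∣⇒≡0 (P.1# , P.*-identityˡ f) ⟩
          []                     ∎
        r≡aw : r ≡ᶠ a * w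
        r≡aw = begin
          r                        ≈⟨ inverseʳ-unique (q * (const u * a)) r qg+r≡0 ⟩
          - (q * (const u * a))    ≈⟨ Q.-‿cong (Q.*-assoc q (const u) a) ⟨
          - (q * const u * a)      ≈⟨ Q.-‿cong (Q.*-comm (q * const u) a) ⟩
          - (a * (q * const u))    ≈⟨ -‿distribʳ-* a (q * const u) ⟩
          a * w                    ∎
      ... | yes r≈0
        with f≈qg ← P.trans f≈qg+r (P.trans (P.+-congˡ r≈0) (P.+-identityʳ _))
        with split-∣1 {q} {const u * a} f≈qg
      ...   | inj₁ (v , vq≈1) = contradiction
        (K.trans (K.sym (leading g-monic)) (coeff-≈ (monic-∣⇒≈0 f-monic f∣g g<n) d)) 1≉0
        where
        g = const u * a
        g<n : Below n g
        g<n = Below-≈ (P.sym (const-* u a)) (Below-· u a<n)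
        f∣g : f ∣ g
        f∣g = v , P.trans (*-congˡ v f≈qg)
                    (P.trans (P.sym (P.*-assoc v q g))
                      (P.trans (*-congʳ g vq≈1) (P.*-identityˡ g)))
      ...   | inj₂ (v , vg≈1) = (v * const u) , (begin
          a * (v * const u)  ≈⟨ x∙yz≈y∙xz a v (const u) ⟩
          v * (a * const u)  ≈⟨ Q.*-congˡ {v} (Q.*-comm a (const u)) ⟩
          v * (const u * a)  ≈⟨ ≈⇒≡ᶠ vg≈1 ⟩
          P.1#               ∎)

  module _ {n : ℕ} (0<n : 0 < n) {f : Poly} (f-monic : MonicOfDegree n f)
           (f-irr : Irreducible f) where

    open Modulo f-monic
    open Quotient polyRing f
    private module Q = CommutativeRing quotientRing
    open import Algebra.Properties.Ring P.ring using ([y-z]x≈yx-zx)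
    open import Algebra.Properties.Group P.+-group using (x∙y⁻¹≈ε⇒x≈y; inverseˡ-unique)

    Below-1# : Below n P.1#
    Below-1# = Below-≤ 0<n (Below-const K.1#)

    -- As a² - 1 = (a - 1) (a + 1), a residue that is its own inverse is 1 or -1.
    self-inverse⇒const : ∀ {a} → Below n a → a * a ≡ᶠ P.1# → ∃ λ c → a ≈ const c
    self-inverse⇒const {a} a<n a²≡1 with ≈[]? (a + (- P.1#))
    ... | yes a-1≈0 = K.1# , x∙y⁻¹≈ε⇒x≈y a P.1# a-1≈0
    ... | no  a-1≉0
      with b , [a-1]b≡1 ← inverse f-irr (Below-+ a<n (Below-‿- Below-1#)) a-1≉0 =
      (K.- K.1#) , inverseˡ-unique a P.1# (≡ᶠ⇒≈ (Below-+ a<n Below-1#) (Below-[] P.refl) a+1≡0)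
      where
      open SetoidReasoning P.setoid
      factor : (a + (- P.1#)) * (a + P.1#) ≈ a * a + (- P.1#)
      factor = begin
        (a + (- P.1#)) * (a + P.1#)
          ≈⟨ P.distribˡ (a + (- P.1#)) a P.1# ⟩
        (a + (- P.1#)) * a + (a + (- P.1#)) * P.1#
          ≈⟨ P.+-cong ([y-z]x≈yx-zx a a P.1#) (P.*-identityʳ _) ⟩
        (a * a + (- (P.1# * a))) + (a + (- P.1#))
          ≈⟨ P.+-congʳ (P.+-congˡ {a * a} (P.-‿cong (P.*-identityˡ a))) ⟩
        (a * a + (- a)) + (a + (- P.1#))
          ≈⟨ telescope (a * a) a P.1# ⟩
        a * a + (- P.1#)
          ∎
      a+1≡0 : a + P.1# ≡ᶠ []
      a+1≡0 = cancel (a + (- P.1#)) [a-1]b≡1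
        (Q.trans (≈⇒≡ᶠ factor) (∣⇒≡0 (∣-difference a²≡1)))

    -- The inverse of a constant is a constant, namely its inverse in the field.
    inverse-const⇒const : ∀ {a c} → Below n a → a * const c ≡ᶠ P.1# → ∃ λ d → a ≈ const d
    inverse-const⇒const {a} {c} a<n ac≡1 = go (c ≟ K.0#)
      where
      open SetoidReasoning Q.setoid
      go : Dec (c K.≈ K.0#) → ∃ λ d → a ≈ const d
      go (yes c≈0) = contradiction (coeff-≈ 1≈0 0) 1≉0
        where
        1≈0 : P.1# ≈ []
        1≈0 = ≡ᶠ⇒≈ Below-1# (Below-[] P.refl) (begin
          P.1#         ≈⟨ ac≡1 ⟨
          a * const c  ≈⟨ ≈⇒≡ᶠ (*-congˡ a (∷≈[] c≈0 P.refl)) ⟩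
          a * []       ≈⟨ Q.zeroʳ a ⟩
          []           ∎)
      go (no c≉0) with d , dc≈1 ← invertible c c≉0 =
        d , ≡ᶠ⇒≈ a<n (Below-≤ 0<n (Below-const d)) (*-inverse-unique (const c)
          (Q.trans (Q.*-comm (const c) a) ac≡1)
          (begin
            const c * const d  ≈⟨ Q.*-comm (const c) (const d) ⟩
            const d * const c  ≈⟨ ≈⇒≡ᶠ (const-* d (const c)) ⟩
            const (d K.* c)    ≈⟨ ≈⇒≡ᶠ (∷-cong dc≈1 P.refl) ⟩
            P.1#               ∎))

  -- Let a and b be inverse to each other modulo two distinct monic polynomials of
  -- degree n, and write a b - 1 = q f₁; then q has degree less than n.  Modulo f₂,
  -- the polynomial f₁ is congruent to e = f₁ - f₂, which is nonzero of degree less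
  -- than n and so invertible.  As f₂ divides q f₁, it divides q, so q = 0 and
  -- a b = 1.
  common-inverse⇒const :
    ∀ {n} → 0 < n → ∀ {f₁ f₂} →
    MonicOfDegree n f₁ → MonicOfDegree n f₂ → Irreducible f₂ → ¬ f₁ ≈ f₂ →
    ∀ {a b} → Below n a → Below n b →
    f₁ ∣ a * b + (- P.1#) → f₂ ∣ a * b + (- P.1#) → ∃ λ c → a ≈ const c
  common-inverse⇒const {n} 0<n {f₁} {f₂} f₁-monic f₂-monic f₂-irr f₁≉f₂ {a} {b} a<n b<n
    (q , qf₁≈ab-1) f₂∣ab-1 = _ , Below-1⇒const a<1
    where
    open Modulo f₂-monic
    open Quotient polyRing f₂
    module Q = CommutativeRing quotientRing
    open import Algebra.Properties.Group P.+-group using (x∙y⁻¹≈ε⇒x≈y)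
    e = f₁ + (- f₂)
    -- The leading coefficients cancel.
    e<n : Below n e
    e<n = Below-pred
      (Below-+ (monic⇒Below f₁-monic) (Below-‿- (monic⇒Below f₂-monic)))
      (K.trans (coeff-+ f₁ (- f₂) n) (K.trans
        (K.+-cong (leading f₁-monic)
          (K.trans (coeff-‿- f₂ n) (K.-‿cong (leading f₂-monic))))
        (K.-‿inverseʳ K.1#)))
    e-inverse : ∃ λ s → e * s ≡ᶠ P.1#
    e-inverse = inverse f₂-irr e<n λ e≈0 → f₁≉f₂ (x∙y⁻¹≈ε⇒x≈y f₁ f₂ e≈0)
    e≡f₁ : e ≡ᶠ f₁
    e≡f₁ = begin
      f₁ + (- f₂)  ≈⟨ Q.+-congˡ {f₁} (Q.-‿cong (∣⇒≡0 (P.1# , P.*-identityˡ f₂))) ⟩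
      f₁ + []      ≈⟨ Q.+-identityʳ f₁ ⟩
      f₁           ∎
      where open SetoidReasoning Q.setoid
    eq≡0 : e * q ≡ᶠ []
    eq≡0 = begin
      e * q             ≈⟨ Q.*-congʳ e≡f₁ ⟩
      f₁ * q            ≈⟨ Q.*-comm f₁ q ⟩
      q * f₁            ≈⟨ ≈⇒≡ᶠ qf₁≈ab-1 ⟩
      a * b + (- P.1#)  ≈⟨ ∣⇒≡0 f₂∣ab-1 ⟩
      []                ∎
      where open SetoidReasoning Q.setoid
    q<n : Below n q
    q<n = monic-cofactor f₁-monic n q (Below-≈ (P.sym qf₁≈ab-1)
      (Below-+ (Below-* a b a<n b<n)
        (Below-‿- (Below-≤ (ℕₚ.≤-trans 0<n (ℕₚ.m≤m+n n n)) (Below-const K.1#)))))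
    q≈0 : q ≈ []
    q≈0 = ≡ᶠ⇒≈ q<n (Below-[] P.refl) (cancel e (proj₂ e-inverse) eq≡0)
    a<1 : Below 1 a
    a<1 = const-factor {b = b} 1≉0 (x∙y⁻¹≈ε⇒x≈y (a * b) P.1#
      (P.trans (P.sym qf₁≈ab-1) (*-zeroˡ f₁ q≈0)))

-- The prime field

-- The integers modulo a prime, with the operations of the raw ring 𝔽.
module PrimeField (p : ℕ) .{{_ : NonZero p}} where

  -- Reduction modulo p, a surjective semiring homomorphism from ℕ: through it
  -- the field inherits its semiring laws.
  φ : ℕ → Fin p
  φ m = m mod p

  toℕ-φ : ∀ m → toℕ (φ m) ≡ m % p
  toℕ-φ m = toℕ-fromℕ< (m%n<n m p)

  φ-cong-% : ∀ {m k} → m % p ≡ k % p → φ m ≡ φ k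
  φ-cong-% {m} {k} e = toℕ-injective (trans (toℕ-φ m) (trans e (sym (toℕ-φ k))))

  φ-toℕ : ∀ a → φ (toℕ a) ≡ a
  φ-toℕ a = toℕ-injective (trans (toℕ-φ (toℕ a)) (m<n⇒m%n≡m (toℕ<n a)))

  infixl 6 _⊕_
  infixl 7 _⊗_
  _⊕_ _⊗_ : Fin p → Fin p → Fin p
  a ⊕ b = φ (toℕ a ℕ.+ toℕ b)
  a ⊗ b = φ (toℕ a ℕ.* toℕ b)

  ⊖_ : Fin p → Fin p
  ⊖ a = φ (p ∸ toℕ a)

  φ-+ : ∀ m k → φ m ⊕ φ k ≡ φ (m ℕ.+ k)
  φ-+ m k = φ-cong-% (trans (cong₂ (λ x y → (x ℕ.+ y) % p) (toℕ-φ m) (toℕ-φ k))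
    (sym (%-distribˡ-+ m k p)))

  φ-* : ∀ m k → φ m ⊗ φ k ≡ φ (m ℕ.* k)
  φ-* m k = φ-cong-% (trans (cong₂ (λ x y → (x ℕ.* y) % p) (toℕ-φ m) (toℕ-φ k))
    (sym (%-distribˡ-* m k p)))

  φ-multiple : ∀ m → φ (m ℕ.* p) ≡ φ 0
  φ-multiple m = φ-cong-% (trans (m*n%n≡0 m p) (sym (m*n%n≡0 0 p)))

  private
    φ-+ʳ : ∀ a k → a ⊕ φ k ≡ φ (toℕ a ℕ.+ k)
    φ-+ʳ a k = trans (cong (_⊕ φ k) (sym (φ-toℕ a))) (φ-+ (toℕ a) k)
    φ-*ʳ : ∀ a k → a ⊗ φ k ≡ φ (toℕ a ℕ.* k)
    φ-*ʳ a k = trans (cong (_⊗ φ k) (sym (φ-toℕ a))) (φ-* (toℕ a) k)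

    ⊕-comm : ∀ a b → a ⊕ b ≡ b ⊕ a
    ⊕-comm a b = cong φ (ℕₚ.+-comm (toℕ a) (toℕ b))

    ⊗-comm : ∀ a b → a ⊗ b ≡ b ⊗ a
    ⊗-comm a b = cong φ (ℕₚ.*-comm (toℕ a) (toℕ b))

    ⊕-assoc : ∀ a b c → (a ⊕ b) ⊕ c ≡ a ⊕ (b ⊕ c)
    ⊕-assoc a b c = begin
      φ (toℕ a ℕ.+ toℕ b) ⊕ c          ≡⟨ ⊕-comm _ c ⟩
      c ⊕ φ (toℕ a ℕ.+ toℕ b)          ≡⟨ φ-+ʳ c _ ⟩
      φ (toℕ c ℕ.+ (toℕ a ℕ.+ toℕ b))  ≡⟨ cong φ (ℕₚ.+-comm (toℕ c) _) ⟩
      φ (toℕ a ℕ.+ toℕ b ℕ.+ toℕ c)    ≡⟨ cong φ (ℕₚ.+-assoc (toℕ a) _ _) ⟩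
      φ (toℕ a ℕ.+ (toℕ b ℕ.+ toℕ c))  ≡⟨ φ-+ʳ a _ ⟨
      a ⊕ φ (toℕ b ℕ.+ toℕ c)          ∎
      where open ≡-Reasoning

    ⊗-assoc : ∀ a b c → (a ⊗ b) ⊗ c ≡ a ⊗ (b ⊗ c)
    ⊗-assoc a b c = begin
      φ (toℕ a ℕ.* toℕ b) ⊗ c          ≡⟨ ⊗-comm _ c ⟩
      c ⊗ φ (toℕ a ℕ.* toℕ b)          ≡⟨ φ-*ʳ c _ ⟩
      φ (toℕ c ℕ.* (toℕ a ℕ.* toℕ b))  ≡⟨ cong φ (ℕₚ.*-comm (toℕ c) _) ⟩
      φ (toℕ a ℕ.* toℕ b ℕ.* toℕ c)    ≡⟨ cong φ (ℕₚ.*-assoc (toℕ a) _ _) ⟩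
      φ (toℕ a ℕ.* (toℕ b ℕ.* toℕ c))  ≡⟨ φ-*ʳ a _ ⟨
      a ⊗ φ (toℕ b ℕ.* toℕ c)          ∎
      where open ≡-Reasoning

    ⊗-distribˡ : ∀ a b c → a ⊗ (b ⊕ c) ≡ a ⊗ b ⊕ a ⊗ c
    ⊗-distribˡ a b c = begin
      a ⊗ φ (toℕ b ℕ.+ toℕ c)                      ≡⟨ φ-*ʳ a _ ⟩
      φ (toℕ a ℕ.* (toℕ b ℕ.+ toℕ c))              ≡⟨ cong φ (ℕₚ.*-distribˡ-+ (toℕ a) _ _) ⟩
      φ (toℕ a ℕ.* toℕ b ℕ.+ toℕ a ℕ.* toℕ c)      ≡⟨ φ-+ _ _ ⟨
      φ (toℕ a ℕ.* toℕ b) ⊕ φ (toℕ a ℕ.* toℕ c)    ∎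
      where open ≡-Reasoning

    ⊕-identityʳ : ∀ a → a ⊕ φ 0 ≡ a
    ⊕-identityʳ a = trans (φ-+ʳ a 0) (trans (cong φ (ℕₚ.+-identityʳ _)) (φ-toℕ a))

    ⊗-identityʳ : ∀ a → a ⊗ φ 1 ≡ a
    ⊗-identityʳ a = trans (φ-*ʳ a 1) (trans (cong φ (ℕₚ.*-identityʳ _)) (φ-toℕ a))

    ⊖-inverseʳ : ∀ a → a ⊕ (⊖ a) ≡ φ 0
    ⊖-inverseʳ a = begin
      a ⊕ φ (p ∸ toℕ a)          ≡⟨ φ-+ʳ a _ ⟩
      φ (toℕ a ℕ.+ (p ∸ toℕ a))  ≡⟨ cong φ (ℕₚ.m+[n∸m]≡n (ℕₚ.<⇒≤ (toℕ<n a))) ⟩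
      φ p                        ≡⟨ cong φ (ℕₚ.*-identityˡ p) ⟨
      φ (1 ℕ.* p)                ≡⟨ φ-multiple 1 ⟩
      φ 0                        ∎
      where open ≡-Reasoning

  𝔽-ring : CommutativeRing 0ℓ 0ℓ
  𝔽-ring = record
    { Carrier = Fin p ; _≈_ = _≡_ ; _+_ = _⊕_ ; _*_ = _⊗_ ; -_ = ⊖_ ; 0# = φ 0 ; 1# = φ 1
    ; isCommutativeRing = record
      { isRing = record
        { +-isAbelianGroup = record
          { isGroup = record
            { isMonoid = record
              { isSemigroup = record
                { isMagma = record { isEquivalence = ≡.isEquivalence ; ∙-cong = cong₂ _⊕_ }
                ; assoc = ⊕-assoc
                }
              ; identity = comm∧idʳ⇒id ⊕-comm ⊕-identityʳ
              }
            ; inverse = comm∧invʳ⇒inv ⊕-comm ⊖-inverseʳ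
            ; ⁻¹-cong = cong ⊖_
            }
          ; comm = ⊕-comm
          }
        ; *-cong     = cong₂ _⊗_
        ; *-assoc    = ⊗-assoc
        ; *-identity = comm∧idʳ⇒id ⊗-comm ⊗-identityʳ
        ; distrib    = comm∧distrˡ⇒distr (cong₂ _⊕_) ⊗-comm ⊗-distribˡ
        }
      ; *-comm = ⊗-comm
      }
    }
    where
    open import Algebra.Consequences.Setoid (≡.setoid (Fin p))
      using (comm∧idʳ⇒id; comm∧invʳ⇒inv; comm∧distrˡ⇒distr)

  module _ (p-prime : Prime p) where

    private
      φ[m]≡0⇒m≡0 : ∀ {m} → m < p → φ m ≡ φ 0 → m ≡ 0
      φ[m]≡0⇒m≡0 {m} m<p e = begin
        m          ≡⟨ m<n⇒m%n≡m m<p ⟨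
        m % p      ≡⟨ toℕ-φ m ⟨
        toℕ (φ m)  ≡⟨ cong toℕ e ⟩
        toℕ (φ 0)  ≡⟨ toℕ-φ 0 ⟩
        0 % p      ≡⟨ m*n%n≡0 0 p ⟩
        0          ∎
        where open ≡-Reasoning

    1≢0 : ¬ φ 1 ≡ φ 0
    1≢0 e with () ← φ[m]≡0⇒m≡0 (ℕ.nonTrivial⇒n>1 p {{prime⇒nonTrivial p-prime}}) e

    -- Bézout's identity for p and a, in either of its subtraction-free forms.
    invertible : ∀ a → ¬ a ≡ φ 0 → ∃ λ b → b ⊗ a ≡ φ 1
    invertible a a≢0 =
      go (coprime-Bézout (prime⇒coprime p-prime {{ℕ.≢-nonZero toℕa≢0}} (toℕ<n a)))
      where
      open ≡-Reasoning
      module 𝔽ₚ = CommutativeRing 𝔽-ring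
      open import Algebra.Properties.Ring 𝔽ₚ.ring using (-‿distribˡ-*)
      open import Algebra.Properties.Group 𝔽ₚ.+-group using (inverseˡ-unique)
      toℕa≢0 : ¬ toℕ a ≡ 0
      toℕa≢0 e = a≢0 (trans (sym (φ-toℕ a)) (cong φ e))
      φ-*a : ∀ y → φ y ⊗ a ≡ φ (y ℕ.* toℕ a)
      φ-*a y = trans (cong (φ y ⊗_) (sym (φ-toℕ a))) (φ-* y (toℕ a))
      go : Bézout.Identity 1 p (toℕ a) → ∃ λ b → b ⊗ a ≡ φ 1
      go (Bézout.-+ x y 1+xp≡ya) = φ y , (begin
        φ y ⊗ a              ≡⟨ φ-*a y ⟩
        φ (y ℕ.* toℕ a)      ≡⟨ cong φ 1+xp≡ya ⟨
        φ (1 ℕ.+ x ℕ.* p)    ≡⟨ φ-+ 1 _ ⟨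
        φ 1 ⊕ φ (x ℕ.* p)    ≡⟨ cong (φ 1 ⊕_) (φ-multiple x) ⟩
        φ 1 ⊕ φ 0            ≡⟨ ⊕-identityʳ (φ 1) ⟩
        φ 1                  ∎)
      go (Bézout.+- x y 1+ya≡xp) = ⊖ φ y , (begin
        (⊖ φ y) ⊗ a          ≡⟨ -‿distribˡ-* (φ y) a ⟨
        ⊖ (φ y ⊗ a)          ≡⟨ cong ⊖_ (φ-*a y) ⟩
        ⊖ φ (y ℕ.* toℕ a)    ≡⟨ inverseˡ-unique (φ 1) (φ (y ℕ.* toℕ a)) (begin
          φ 1 ⊕ φ (y ℕ.* toℕ a)    ≡⟨ φ-+ 1 _ ⟩
          φ (1 ℕ.+ y ℕ.* toℕ a)    ≡⟨ cong φ 1+ya≡xp ⟩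
          φ (x ℕ.* p)              ≡⟨ φ-multiple x ⟩
          φ 0                      ∎) ⟨
        φ 1                  ∎)

-- Natural numbers and cycles

-- The least natural number with a decidable property.
least : {P : Pred ℕ 0ℓ} → DecidablePred P → ∀ n → P n → ∃ λ m → P m × (∀ {j} → j < m → ¬ P j)
least P? zero    Pn = zero , Pn , λ ()
least P? (suc n) Pn with P? zero
... | yes P0 = zero , P0 , λ ()
... | no ¬P0 with m , Pm , below-m ← least (P? ∘ suc) n Pn =
  suc m , Pm , λ { {zero} _ → ¬P0 ; {suc j} (s≤s j<m) → below-m j<m }

even⊎odd : ∀ m → ∃ λ k → m ≡ k ℕ.* 2 ⊎ m ≡ suc (k ℕ.* 2)
even⊎odd zero    = 0 , inj₁ refl
even⊎odd (suc m) with even⊎odd m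
... | k , inj₁ e = k , inj₂ (cong suc e)
... | k , inj₂ e = suc k , inj₁ (cong suc e)

module _ {V : Set} where

  open Cycle

  Disjoint : Cycle V → Cycle V → Set
  Disjoint C D = ∀ v → v ∈ᵛ C → ¬ v ∈ᵛ D

  walk∈ᵛ : ∀ (C : Cycle V) j → walk C j ∈ᵛ C
  walk∈ᵛ C j with view j
  ... | ‵inject₁ i = i , refl
  walk∈ᵛ record { len>0 = s≤s _ ; closed = closed } .(fromℕ _) | ‵fromℕ = zero , sym closed

  Edge-target∈ᵛ : ∀ (C : Cycle V) {u v} → Edge C u v → v ∈ᵛ C
  Edge-target∈ᵛ C (i , inj₁ (_ , refl)) = walk∈ᵛ C (suc i)
  Edge-target∈ᵛ C (i , inj₂ (refl , _)) = i , refl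

  Edge-source∈ᵛ : ∀ (C : Cycle V) {u v} → Edge C u v → u ∈ᵛ C
  Edge-source∈ᵛ C (i , inj₁ (refl , _)) = i , refl
  Edge-source∈ᵛ C (i , inj₂ (_ , refl)) = walk∈ᵛ C (suc i)

  disjoint⇒index-unique : ∀ {Cs : List (Cycle V)} → AllPairs Disjoint Cs →
                          ∀ {v} i j → v ∈ᵛ lookup Cs i → v ∈ᵛ lookup Cs j → i ≡ j
  disjoint⇒index-unique (_ ∷ _)  zero    zero    _   _   = refl
  disjoint⇒index-unique (d ∷ _)  zero    (suc j) v∈C v∈D =
    contradiction v∈D (All.lookup d (∈-lookup j) _ v∈C)
  disjoint⇒index-unique (d ∷ _)  (suc i) zero    v∈C v∈D =
    contradiction v∈C (All.lookup d (∈-lookup i) _ v∈D)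
  disjoint⇒index-unique (_ ∷ ds) (suc i) (suc j) v∈C v∈D =
    cong suc (disjoint⇒index-unique ds i j v∈C v∈D)

-- Cycles of two disjoint perfect matchings

-- Two fixed-point-free involutions i₁ and i₂ on a set S that agree nowhere on S
-- are two disjoint perfect matchings of S, whose union is 2-regular.
record TwoMatchings {V : Set} (S : Pred V 0ℓ) : Set where
  field
    i₁ i₂         : V → V
    i₁-closed     : ∀ {x} → S x → S (i₁ x)
    i₂-closed     : ∀ {x} → S x → S (i₂ x)
    i₁-involutive : ∀ {x} → S x → i₁ (i₁ x) ≡ x
    i₂-involutive : ∀ {x} → S x → i₂ (i₂ x) ≡ x
    i₁-moves      : ∀ {x} → S x → ¬ i₁ x ≡ x
    i₂-moves      : ∀ {x} → S x → ¬ i₂ x ≡ x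
    disagree      : ∀ {x} → S x → ¬ i₁ x ≡ i₂ x

module Alternating {V : Set} {S : Pred V 0ℓ} (M : TwoMatchings S) where

  open TwoMatchings M
  open Cycle

  -- The involution applied in step m of an alternating walk, counting from 0.
  step : ℕ → V → V
  step zero          = i₁
  step (suc zero)    = i₂
  step (suc (suc m)) = step m

  step-closed : ∀ m {x} → S x → S (step m x)
  step-closed zero          = i₁-closed
  step-closed (suc zero)    = i₂-closed
  step-closed (suc (suc m)) = step-closed m

  step-involutive : ∀ m {x} → S x → step m (step m x) ≡ x
  step-involutive zero          = i₁-involutive
  step-involutive (suc zero)    = i₂-involutive
  step-involutive (suc (suc m)) = step-involutive m

  step-moves : ∀ m {x} → S x → ¬ step m x ≡ x
  step-moves zero          = i₁-moves
  step-moves (suc zero)    = i₂-moves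
  step-moves (suc (suc m)) = step-moves m

  step-injective : ∀ m {x y} → S x → S y → step m x ≡ step m y → x ≡ y
  step-injective m Sx Sy e = trans (sym (step-involutive m Sx))
    (trans (cong (step m) e) (step-involutive m Sy))

  step-shift : ∀ k m x → step (k ℕ.* 2 ℕ.+ m) x ≡ step m x
  step-shift zero    m x = refl
  step-shift (suc k) m x = step-shift k m x

  step-odd : ∀ {m} x → 2 ℕ∣.∣ suc m → step m x ≡ i₂ x
  step-odd x (divides (suc zero)    refl) = refl
  step-odd {suc (suc m)} x (divides (suc (suc k)) e) =
    step-odd x (divides (suc k) (ℕₚ.suc-injective (ℕₚ.suc-injective e)))

  step-even : ∀ {m} x → 2 ℕ∣.∤ suc m → step m x ≡ i₁ x
  step-even {zero}        x odd = refl
  step-even {suc zero}    x odd = contradiction (divides 1 refl) odd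
  step-even {suc (suc m)} x odd = step-even {m} x (odd ∘ λ { (divides k e) →
    divides (suc k) (cong (2 ℕ.+_) e) })

  -- Consecutive steps are i₁ and i₂, in some order.
  both-steps : ∀ (P : V → Set) m {x} → P (step m x) → P (step (suc m) x) → P (i₁ x) × P (i₂ x)
  both-steps P zero          p q = p , q
  both-steps P (suc zero)    p q = q , p
  both-steps P (suc (suc m)) p q = both-steps P m p q

  step-either : ∀ m x → step m x ≡ i₁ x ⊎ step m x ≡ i₂ x
  step-either zero          x = inj₁ refl
  step-either (suc zero)    x = inj₂ refl
  step-either (suc (suc m)) x = step-either m x

  -- A closed walk of even length in S whose steps are i₁, i₂, i₁, i₂, and so on.
  record IsAlternating (C : Cycle V) : Set where
    field
      start∈S   : S (walk C zero)
      even-len  : 2 ℕ∣.∣ len C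
      alternate : ∀ i → walk C (suc i) ≡ step (toℕ i) (walk C (inject₁ i))

    walk∈S : ∀ j → S (walk C j)
    walk∈S = <-weakInduction (S ∘ walk C) start∈S λ i Sx →
      subst S (sym (alternate i)) (step-closed (toℕ i) Sx)

  -- Reach a v: some sequence of applications of i₁ and i₂ takes a to v.
  data Reach (a : V) : V → Set where
    here : Reach a a
    by₁  : ∀ {v} → Reach a v → Reach a (i₁ v)
    by₂  : ∀ {v} → Reach a v → Reach a (i₂ v)

  Reach-S : ∀ {a v} → S a → Reach a v → S v
  Reach-S Sa here    = Sa
  Reach-S Sa (by₁ r) = i₁-closed (Reach-S Sa r)
  Reach-S Sa (by₂ r) = i₂-closed (Reach-S Sa r)

  Reach-trans : ∀ {a b c} → Reach a b → Reach b c → Reach a c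
  Reach-trans r here    = r
  Reach-trans r (by₁ s) = by₁ (Reach-trans r s)
  Reach-trans r (by₂ s) = by₂ (Reach-trans r s)

  Reach-sym : ∀ {a b} → S a → Reach a b → Reach b a
  Reach-sym Sa here = here
  Reach-sym Sa (by₁ {v} r) = Reach-trans
    (subst (Reach (i₁ v)) (i₁-involutive (Reach-S Sa r)) (by₁ here)) (Reach-sym Sa r)
  Reach-sym Sa (by₂ {v} r) = Reach-trans
    (subst (Reach (i₂ v)) (i₂-involutive (Reach-S Sa r)) (by₂ here)) (Reach-sym Sa r)

  Reach-step : ∀ m {a v} → Reach a v → Reach a (step m v)
  Reach-step zero          = by₁
  Reach-step (suc zero)    = by₂
  Reach-step (suc (suc m)) = Reach-step m

  module _ {C : Cycle V} (alt : IsAlternating C) where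

    open IsAlternating alt

    ∈ᵛ-S : ∀ {v} → v ∈ᵛ C → S v
    ∈ᵛ-S (i , refl) = walk∈S (inject₁ i)

    Edge⇒step : ∀ {u v} → Edge C u v → v ≡ i₁ u ⊎ v ≡ i₂ u
    Edge⇒step (i , inj₁ (refl , refl)) =
      subst (λ w → w ≡ _ ⊎ w ≡ _) (sym (alternate i)) (step-either (toℕ i) _)
    Edge⇒step (i , inj₂ (refl , refl)) = [ inj₁ ∘ trans back , inj₂ ∘ trans back ]′
      (step-either (toℕ i) (walk C (suc i)))
      where
      back : walk C (inject₁ i) ≡ step (toℕ i) (walk C (suc i))
      back = sym (trans (cong (step (toℕ i)) (alternate i))
        (step-involutive (toℕ i) (walk∈S (inject₁ i))))

  -- Every vertex of an alternating cycle is joined to its images under i₁ and i₂: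
  -- one is the successor, the other the predecessor.  Before the first vertex
  -- comes the last, along an edge of i₂ as the length is even.
  next-edge : ∀ {C} → IsAlternating C → ∀ i →
              Edge C (walk C (inject₁ i)) (step (toℕ i) (walk C (inject₁ i)))
  next-edge alt i = i , inj₁ (refl , IsAlternating.alternate alt i)

  previous-edge : ∀ {C} → IsAlternating C → ∀ i →
                  Edge C (walk C (inject₁ i)) (step (suc (toℕ i)) (walk C (inject₁ i)))
  previous-edge {record { len = suc l ; walk = w ; closed = closed }} alt zero =
    fromℕ l , inj₂ (sym back , closed)
    where
    open IsAlternating alt
    open ≡-Reasoning
    last = w (inject₁ (fromℕ l))
    back : i₂ (w zero) ≡ last
    back = begin
      i₂ (w zero)                        ≡⟨ cong i₂ closed ⟨
      i₂ (w (suc (fromℕ l)))             ≡⟨ cong i₂ (alternate (fromℕ l)) ⟩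
      i₂ (step (toℕ (fromℕ l)) last)     ≡⟨ cong i₂ (cong (λ m → step m last) (toℕ-fromℕ l)) ⟩
      i₂ (step l last)                   ≡⟨ cong i₂ (step-odd last even-len) ⟩
      i₂ (i₂ last)                       ≡⟨ i₂-involutive (walk∈S (inject₁ (fromℕ l))) ⟩
      last                               ∎
  previous-edge {record { len = suc l ; walk = w }} alt (suc i) =
    inject₁ i , inj₂ (sym back , refl)
    where
    open IsAlternating alt
    open ≡-Reasoning
    u = w (inject₁ (inject₁ i))
    back : step (toℕ i) (w (suc (inject₁ i))) ≡ u
    back = begin
      step (toℕ i) (w (suc (inject₁ i)))        ≡⟨ cong (step (toℕ i)) (alternate (inject₁ i)) ⟩
      step (toℕ i) (step (toℕ (inject₁ i)) u)
        ≡⟨ cong (λ m → step (toℕ i) (step m u)) (toℕ-inject₁ i) ⟩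
      step (toℕ i) (step (toℕ i) u)
        ≡⟨ step-involutive (toℕ i) (walk∈S (inject₁ (inject₁ i))) ⟩
      u                                         ∎

  edges-at : ∀ {C} → IsAlternating C → ∀ {v} → v ∈ᵛ C → Edge C v (i₁ v) × Edge C v (i₂ v)
  edges-at {C} alt (i , refl) =
    both-steps (Edge C _) (toℕ i) (next-edge alt i) (previous-edge alt i)

  Reach⇒∈ᵛ : ∀ {C} → IsAlternating C → ∀ {u v} → u ∈ᵛ C → Reach u v → v ∈ᵛ C
  Reach⇒∈ᵛ alt u∈C here    = u∈C
  Reach⇒∈ᵛ {C} alt u∈C (by₁ r) =
    Edge-target∈ᵛ C (proj₁ (edges-at alt (Reach⇒∈ᵛ alt u∈C r)))
  Reach⇒∈ᵛ {C} alt u∈C (by₂ r) =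
    Edge-target∈ᵛ C (proj₂ (edges-at alt (Reach⇒∈ᵛ alt u∈C r)))

  ∈ᵛ⇒Reach : ∀ {C} → IsAlternating C → ∀ {u v} → u ∈ᵛ C → v ∈ᵛ C → Reach u v
  ∈ᵛ⇒Reach {C} alt (i , refl) (j , refl) =
    Reach-trans (Reach-sym start∈S (from-start (inject₁ i))) (from-start (inject₁ j))
    where
    open IsAlternating alt
    from-start : ∀ j → Reach (walk C zero) (walk C j)
    from-start = <-weakInduction (Reach (walk C zero) ∘ walk C) here λ i r →
      subst (Reach _) (sym (alternate i)) (Reach-step (toℕ i) r)

  -- An alternating cycle is determined by any of its vertices.
  common-vertex⇒≅ : ∀ {C D} → IsAlternating C → IsAlternating D →
                    ∀ {v} → v ∈ᵛ C → v ∈ᵛ D → C ≅ D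
  common-vertex⇒≅ {C} {D} altC altD v∈C v∈D = record
    { vertices = λ u → mk⇔ (transfer altC altD v∈C v∈D) (transfer altD altC v∈D v∈C)
    ; edges    = λ u w → mk⇔ (transfer-edge altC altD v∈C v∈D) (transfer-edge altD altC v∈D v∈C)
    }
    where
    transfer : ∀ {C D} → IsAlternating C → IsAlternating D →
               ∀ {v u} → v ∈ᵛ C → v ∈ᵛ D → u ∈ᵛ C → u ∈ᵛ D
    transfer altC altD v∈C v∈D u∈C = Reach⇒∈ᵛ altD v∈D (∈ᵛ⇒Reach altC v∈C u∈C)
    transfer-edge : ∀ {C D} → IsAlternating C → IsAlternating D →
                    ∀ {v u w} → v ∈ᵛ C → v ∈ᵛ D → Edge C u w → Edge D u w
    transfer-edge {C} altC altD v∈C v∈D uw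
      with edges-at altD (transfer altC altD v∈C v∈D (Edge-source∈ᵛ C uw)) | Edge⇒step altC uw
    ... | e , _ | inj₁ refl = e
    ... | _ , e | inj₂ refl = e

  -- A closed alternating walk of length 2 would make i₁ and i₂ agree.
  alternating⇒EvenLength≥4 : ∀ {C} → IsAlternating C → EvenLength≥4 C
  alternating⇒EvenLength≥4 {C} alt = IsAlternating.even-len alt , go C alt
    where
    go : ∀ C → IsAlternating C → 4 ≤ len C
    go record { len = zero ; len>0 = () } alt
    go record { len = 1 } alt with IsAlternating.even-len alt
    ... | divides zero ()
    ... | divides (suc _) ()
    go record { len = 2 ; walk = w ; closed = closed } alt = contradiction (begin
      i₁ (w zero)              ≡⟨ alternate zero ⟨
      w (suc zero)             ≡⟨ i₂-involutive (walk∈S (suc zero)) ⟨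
      i₂ (i₂ (w (suc zero)))   ≡⟨ cong i₂ (alternate (suc zero)) ⟨
      i₂ (w (suc (suc zero)))  ≡⟨ cong i₂ closed ⟩
      i₂ (w zero)              ∎) (disagree start∈S)
      where
      open IsAlternating alt
      open ≡-Reasoning
    go record { len = 3 } alt with IsAlternating.even-len alt
    ... | divides zero ()
    ... | divides (suc zero) ()
    ... | divides (suc (suc _)) ()
    go record { len = suc (suc (suc (suc _))) } alt = s≤s (s≤s (s≤s (s≤s z≤n)))

  -- The infinite alternating walk from a.
  orbit : V → ℕ → V
  orbit a zero    = a
  orbit a (suc m) = step m (orbit a m)

  module _ {a : V} (Sa : S a) where

    orbit-S : ∀ m → S (orbit a m)
    orbit-S zero    = Sa
    orbit-S (suc m) = step-closed m (orbit-S m)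

    -- If positions k * 2 + m and m carry the same vertex, then so do k * 2 and 0, as
    -- equal steps lead back from both.
    orbit-rewind : ∀ k m → orbit a (k ℕ.* 2 ℕ.+ m) ≡ orbit a m → orbit a (k ℕ.* 2) ≡ a
    orbit-rewind k zero    e = subst (λ l → orbit a l ≡ a) (ℕₚ.+-identityʳ (k ℕ.* 2)) e
    orbit-rewind k (suc m) e = orbit-rewind k m
      (step-injective m (orbit-S (k ℕ.* 2 ℕ.+ m)) (orbit-S m) (begin
        step m (orbit a (k ℕ.* 2 ℕ.+ m))                ≡⟨ step-shift k m _ ⟨
        orbit a (suc (k ℕ.* 2 ℕ.+ m))                   ≡⟨ cong (orbit a) (ℕₚ.+-suc (k ℕ.* 2) m) ⟨
        orbit a (k ℕ.* 2 ℕ.+ suc m)                     ≡⟨ e ⟩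
        orbit a (suc m)                                 ∎))
      where open ≡-Reasoning

    -- Positions of different parity never carry the same vertex: walking inwards
    -- from both would lead to a fixed point of i₁ or i₂.
    orbit-odd : ∀ k m → ¬ orbit a (suc (k ℕ.* 2 ℕ.+ m)) ≡ orbit a m
    orbit-odd zero    m e = step-moves m (orbit-S m) e
    orbit-odd (suc k) m e = orbit-odd k (suc m) (begin
      orbit a (suc (k ℕ.* 2 ℕ.+ suc m))            ≡⟨ cong (orbit a ∘ suc) (ℕₚ.+-suc (k ℕ.* 2) m) ⟩
      x
        ≡⟨ step-involutive m (orbit-S (suc (suc (k ℕ.* 2 ℕ.+ m)))) ⟨
      step m (step m x)                            ≡⟨ cong (step m) (step-shift k m x) ⟨
      step m (step (k ℕ.* 2 ℕ.+ m) x)              ≡⟨ cong (step m) e ⟩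
      step m (orbit a m)                           ∎)
      where
      open ≡-Reasoning
      x = orbit a (suc (suc (k ℕ.* 2 ℕ.+ m)))

    -- If suc k * 2 is the least even period of the orbit of a, then the walk closes
    -- up there without an earlier repetition.
    orbit-cycle : ∀ k → orbit a (suc k ℕ.* 2) ≡ a →
                  (∀ {j} → j < k → ¬ orbit a (suc j ℕ.* 2) ≡ a) → Cycle V
    orbit-cycle k period minimal = record
      { len      = suc k ℕ.* 2
      ; walk     = orbit a ∘ toℕ
      ; len>0    = s≤s z≤n
      ; closed   = trans (cong (orbit a) (toℕ-fromℕ (suc k ℕ.* 2))) period
      ; distinct = λ {i} {j} e → toℕ-injective (no-repeat (toℕ<n i) (toℕ<n j)
          (subst₂ (λ m l → orbit a m ≡ orbit a l) (toℕ-inject₁ i) (toℕ-inject₁ j) e))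
      }
      where
      -- Positions m and l differ by suc d; the two cases are odd and even distance.
      apart : ∀ {m l} → m < l → l < suc k ℕ.* 2 → ¬ orbit a l ≡ orbit a m
      apart {m} {l} m<l l<len e with d , m+1+d≡l ← ℕₚ.m≤n⇒∃[o]m+o≡n m<l
        with l≡ ← trans (ℕₚ.+-comm d (suc m)) m+1+d≡l with even⊎odd d
      ... | q , inj₁ refl = orbit-odd q m
              (trans (cong (orbit a) (trans (sym (ℕₚ.+-suc (q ℕ.* 2) m)) l≡)) e)
      ... | q , inj₂ refl = minimal q<k (orbit-rewind (suc q) m
              (trans (cong (orbit a) l≡′) e))
        where
        l≡′ : suc q ℕ.* 2 ℕ.+ m ≡ l
        l≡′ = trans (cong suc (sym (ℕₚ.+-suc (q ℕ.* 2) m))) l≡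
        q<k : q < k
        q<k = ℕₚ.≤-pred (ℕₚ.*-cancelʳ-< 2 (suc q) (suc k)
          (ℕₚ.≤-<-trans (ℕₚ.m≤m+n (suc q ℕ.* 2) m) (subst (_< suc k ℕ.* 2) (sym l≡′) l<len)))
      no-repeat : ∀ {m l} → m < suc k ℕ.* 2 → l < suc k ℕ.* 2 → orbit a m ≡ orbit a l → m ≡ l
      no-repeat {m} {l} m<len l<len e with ℕₚ.<-cmp m l
      ... | tri< m<l _ _ = contradiction (sym e) (apart m<l l<len)
      ... | tri≈ _ m≡l _ = m≡l
      ... | tri> _ _ l<m = contradiction e (apart l<m m<len)

  -- V is finite: it is enumerated, with repetitions allowed, by Fin N.
  module Finite (S? : DecidablePred S) {N : ℕ} (element : Fin N → V) (code : V → Fin N)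
                (element-code : ∀ v → element (code v) ≡ v) (_≟_ : DecidableEquality V) where

    -- Two of the first N + 1 even positions of the orbit of a carry the same vertex.
    period : ∀ {a} → S a → ∃ λ k → orbit a (suc k ℕ.* 2) ≡ a
    period {a} Sa
      with i , j , i<j , e ← pigeonhole (ℕₚ.n<1+n N) (λ i → code (orbit a (toℕ i ℕ.* 2)))
      with k , j≡ ← ℕₚ.m≤n⇒∃[o]m+o≡n i<j = k , orbit-rewind Sa (suc k) (toℕ i ℕ.* 2) (begin
        orbit a (suc k ℕ.* 2 ℕ.+ toℕ i ℕ.* 2)
          ≡⟨ cong (orbit a) (ℕₚ.*-distribʳ-+ 2 (suc k) (toℕ i)) ⟨
        orbit a ((suc k ℕ.+ toℕ i) ℕ.* 2)
          ≡⟨ cong (λ l → orbit a (l ℕ.* 2)) (trans (cong suc (ℕₚ.+-comm k (toℕ i))) j≡) ⟩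
        orbit a (toℕ j ℕ.* 2)                      ≡⟨ element-code _ ⟨
        element (code (orbit a (toℕ j ℕ.* 2)))     ≡⟨ cong element e ⟨
        element (code (orbit a (toℕ i ℕ.* 2)))     ≡⟨ element-code _ ⟩
        orbit a (toℕ i ℕ.* 2)                      ∎)
      where open ≡-Reasoning

    cycle-through : ∀ {a} → S a → ∃ λ C → IsAlternating C × walk C zero ≡ a
    cycle-through {a} Sa
      with k , orbit-k≡a ← period Sa
      with k , period , minimal ← least (λ k → orbit a (suc k ℕ.* 2) ≟ a) k orbit-k≡a =
      orbit-cycle Sa k period minimal , record
        { start∈S   = Sa
        ; even-len  = divides (suc k) refl
        ; alternate = λ i → cong (λ m → step (toℕ i) (orbit a m)) (sym (toℕ-inject₁ i))
        } , refl

    _∈ᵛ?_ : ∀ v C → Dec (v ∈ᵛ C)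
    v ∈ᵛ? C = any? λ i → walk C (inject₁ i) ≟ v

    -- Pairwise disjoint alternating cycles that cover the given vertices of S: the
    -- cycle through a vertex is added unless an earlier one contains that vertex.
    cover : ∀ vs → ∃ λ Cs → All IsAlternating Cs
                   × AllPairs Disjoint Cs
                   × (∀ v → v ∈ vs → S v → Any (v ∈ᵛ_) Cs)
    cover []       = [] , [] , [] , λ _ ()
    cover (v ∷ vs) with cover vs | S? v
    ... | Cs , alts , disjoint , covers | no ¬Sv = Cs , alts , disjoint , λ
      { w (here refl) Sw → contradiction Sw ¬Sv
      ; w (there w∈vs) Sw → covers w w∈vs Sw }
    ... | Cs , alts , disjoint , covers | yes Sv with Any.any? (v ∈ᵛ?_) Cs
    ...   | yes v∈Cs = Cs , alts , disjoint , λ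
      { w (here refl) Sw → v∈Cs
      ; w (there w∈vs) Sw → covers w w∈vs Sw }
    ...   | no v∉Cs with C , alt , refl ← cycle-through Sv =
      C ∷ Cs , alt ∷ alts , All.tabulate new-disjoint ∷ disjoint , λ
      { w (here refl) Sw → here (walk∈ᵛ C zero)
      ; w (there w∈vs) Sw → there (covers w w∈vs Sw) }
      where
      new-disjoint : ∀ {D} → D ∈ Cs → Disjoint C D
      new-disjoint D∈Cs w w∈C w∈D = v∉Cs (Any.map
        (λ { refl → Reach⇒∈ᵛ (All.lookup alts D∈Cs) w∈D
               (∈ᵛ⇒Reach alt w∈C (walk∈ᵛ C zero)) }) D∈Cs)

    partition : ∃ λ Cs → All IsAlternating Cs × IsPartition S Cs
    partition with Cs , alts , disjoint , covers ← cover (map element (allFin N)) =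
      Cs , alts , record
        { within = λ i v v∈ → ∈ᵛ-S (All.lookup alts (∈-lookup i)) v∈
        ; covers = λ v Sv → let v∈Cs = covers v (v∈all v) Sv in
            index v∈Cs , lookup-index v∈Cs ,
            λ {j} → disjoint⇒index-unique disjoint (index v∈Cs) j (lookup-index v∈Cs)
        }
      where
      v∈all : ∀ v → v ∈ map element (allFin N)
      v∈all v = subst (_∈ map element (allFin N)) (element-code v)
        (∈-map⁺ element (∈-allFin (code v)))

-- Inverse chains of polynomials over the prime field

module PrimeChaining (p : ℕ) .{{_ : NonZero p}} (p-prime : Prime p) where

  open InverseChaining p
  open PrimeField p
  open PolynomialRing 𝔽-ring using (polyRing; coeff-≈; ∷≈[]; ∷-cong; *-congˡ)
  open MonicDivision 𝔽-ring
  open FieldPolynomials 𝔽-ring Finₚ._≟_ (1≢0 p-prime) (invertible p-prime)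
  private module P = CommutativeRing polyRing

  ⟦⟧-Below : ∀ {n} (v : 𝒫 n) → Below n ⟦ v ⟧
  ⟦⟧-Below []      = Below-[] P.refl
  ⟦⟧-Below (a ∷ v) = Below-∷ (⟦⟧-Below v)

  ⟦⟧-injective : ∀ {n} (u v : 𝒫 n) → ⟦ u ⟧ ≈ ⟦ v ⟧ → u ≡ v
  ⟦⟧-injective []      []      e = refl
  ⟦⟧-injective (a ∷ u) (b ∷ v) e =
    cong₂ _∷_ (coeff-≈ e 0) (⟦⟧-injective u v (mk≈ λ m → coeff-≈ e (suc m)))

  -- The first n coefficients, padded by zeros.
  truncate : ∀ n → Poly → 𝒫 n
  truncate zero    g       = []
  truncate (suc n) []      = φ 0 ∷ truncate n []
  truncate (suc n) (a ∷ g) = a ∷ truncate n g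

  ⟦truncate⟧ : ∀ {n g} → Below n g → ⟦ truncate n g ⟧ ≈ g
  ⟦truncate⟧ {zero}          g<n = P.sym (Below-0 g<n)
  ⟦truncate⟧ {suc n} {[]}    g<n = ∷≈[] refl (⟦truncate⟧ (Below-[] P.refl))
  ⟦truncate⟧ {suc n} {a ∷ g} g<n = ∷-cong refl (⟦truncate⟧ (Below-tail g<n))

  nonConstant? : ∀ {n} → DecidablePred (NonConstant {n})
  nonConstant? a = ¬? (any? λ c → ⟦ a ⟧ ≈? const c)

  module Inverse {n : ℕ} (0<n : 0 < n) {f : Poly} (f-monic : MonicOfDegree n f)
                 (f-irr : Irreducible f) where

    open Modulo f-monic
    open Quotient polyRing f
    private module Q = CommutativeRing quotientRing

    exists-inverse : ∀ a → ¬ ⟦ a ⟧ ≈ [] → ∃ λ b → IsInverse f a b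
    exists-inverse a a≉0
      with b , ab≡1 ← inverse f-irr (⟦⟧-Below a) a≉0
      with r , r<n , b≡r ← remainder b =
      truncate n r , ∣-difference aᵗ≡1 , λ c ac≡1 →
        ⟦⟧-injective (truncate n r) c (≡ᶠ⇒≈ (⟦⟧-Below (truncate n r)) (⟦⟧-Below c)
          (*-inverse-unique ⟦ a ⟧ aᵗ≡1 (mk≡ ac≡1)))
      where
      open import Relation.Binary.Reasoning.Setoid Q.setoid
      aᵗ≡1 : ⟦ a ⟧ * ⟦ truncate n r ⟧ ≡ᶠ P.1#
      aᵗ≡1 = begin
        ⟦ a ⟧ * ⟦ truncate n r ⟧  ≈⟨ ≈⇒≡ᶠ (*-congˡ ⟦ a ⟧ (⟦truncate⟧ r<n)) ⟩
        ⟦ a ⟧ * r                 ≈⟨ Q.*-congˡ {⟦ a ⟧} b≡r ⟨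
        ⟦ a ⟧ * b                 ≈⟨ ab≡1 ⟩
        P.1#                      ∎

    -- inv_f, extended by the junk value inv_f(0) = 0.
    inv : 𝒫 n → 𝒫 n
    inv a with ≈[]? ⟦ a ⟧
    ... | yes _  = a
    ... | no a≉0 = proj₁ (exists-inverse a a≉0)

    inv-isInverse : ∀ {a} → NonConstant a → IsInverse f a (inv a)
    inv-isInverse {a} a-nc with ≈[]? ⟦ a ⟧
    ... | yes a≈0 = contradiction (φ 0 , P.trans a≈0 (P.sym (∷≈[] refl P.refl))) a-nc
    ... | no a≉0  = proj₂ (exists-inverse a a≉0)

    IsInverse⇒≡inv : ∀ {a b} → NonConstant a → IsInverse f a b → b ≡ inv a
    IsInverse⇒≡inv a-nc (_ , unique) = unique _ (proj₁ (inv-isInverse a-nc))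

    *-inv : ∀ {a} → NonConstant a → ⟦ a ⟧ * ⟦ inv a ⟧ ≡ᶠ P.1#
    *-inv a-nc = mk≡ (proj₁ (inv-isInverse a-nc))

    inv-closed : ∀ {a} → NonConstant a → NonConstant (inv a)
    inv-closed {a} a-nc (c , e) = a-nc (inverse-const⇒const 0<n f-monic f-irr (⟦⟧-Below a)
      (Q.trans (≈⇒≡ᶠ (*-congˡ ⟦ a ⟧ (P.sym e))) (*-inv a-nc)))

    inv-involutive : ∀ {a} → NonConstant a → inv (inv a) ≡ a
    inv-involutive {a} a-nc = proj₂ (inv-isInverse (inv-closed a-nc)) a
      (∣-difference (Q.trans (Q.*-comm ⟦ inv a ⟧ ⟦ a ⟧) (*-inv a-nc)))

    inv-moves : ∀ {a} → NonConstant a → ¬ inv a ≡ a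
    inv-moves {a} a-nc e = a-nc (self-inverse⇒const 0<n f-monic f-irr (⟦⟧-Below a)
      (subst (λ b → ⟦ a ⟧ * ⟦ b ⟧ ≡ᶠ P.1#) e (*-inv a-nc)))

  -- An induced partition is determined by the inverse chains: each of its cycles is
  -- the one traversed by the inverse chain of any of its vertices.
  induced-⊆ : ∀ {n f₁ f₂} {Cs Ds : List (Cycle (𝒫 n))} →
              IsInducedPartition f₁ f₂ Cs → IsInducedPartition f₁ f₂ Ds →
              ∀ {C} → Any (C ≅_) Ds → Any (C ≅_) Cs
  induced-⊆ {n} {Cs = Cs} {Ds} inducedC inducedD {C} C∈Ds =
    let i            = index C∈Ds
        D            = lookup Ds i
        v            = Cycle.walk D zero
        v∈D          = walk∈ᵛ D zero
        v-nc         = IsPartition.within IPD.isPartition i v v∈D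
        E , chain    = IPD.hasChain v v-nc
        j , v∈Cⱼ , _ = IsPartition.covers IPC.isPartition v v-nc
        C≅E          = ≅.trans (lookup-index C∈Ds) (≅.sym (IPD.traverses v v-nc E chain i v∈D))
        E≅Cⱼ         = IPC.traverses v v-nc E chain j v∈Cⱼ
    in Any.map (λ { refl → ≅.trans C≅E E≅Cⱼ }) (∈-lookup {xs = Cs} j)
    where
    module IPC = IsInducedPartition inducedC
    module IPD = IsInducedPartition inducedD
    module ≅ = Setoid (cycleSetoid {𝒫 n})

  module Pair {n : ℕ} (0<n : 0 < n) {f₁ f₂ : Poly}
              (f₁-monic : MonicOfDegree n f₁) (f₁-irr : Irreducible f₁)
              (f₂-monic : MonicOfDegree n f₂) (f₂-irr : Irreducible f₂)
              (f₁≉f₂ : ¬ f₁ ≈ f₂) where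

    private
      module I₁ = Inverse 0<n f₁-monic f₁-irr
      module I₂ = Inverse 0<n f₂-monic f₂-irr

    -- The two inversions, as matchings of the nonconstant polynomials.
    matchings : TwoMatchings (NonConstant {n})
    matchings = record
      { i₁ = I₁.inv ; i₁-closed = I₁.inv-closed
      ; i₁-involutive = I₁.inv-involutive ; i₁-moves = I₁.inv-moves
      ; i₂ = I₂.inv ; i₂-closed = I₂.inv-closed
      ; i₂-involutive = I₂.inv-involutive ; i₂-moves = I₂.inv-moves
      ; disagree = λ {a} a-nc e → a-nc
          (common-inverse⇒const 0<n f₁-monic f₂-monic f₂-irr f₁≉f₂
            (⟦⟧-Below a) (⟦⟧-Below (I₁.inv a))
            (proj₁ (I₁.inv-isInverse a-nc))
            (subst (λ b → ⟦ a ⟧ * ⟦ b ⟧ ≡ const (φ 1) [mod f₂ ]) (sym e)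
              (proj₁ (I₂.inv-isInverse a-nc))))
      }

    open Alternating matchings
    open Cycle

    -- Inverse chains are the alternating cycles, as odd-numbered chain elements arise
    -- by steps that count as even from 0.
    chain⇒alternating : ∀ {a C} → NonConstant a → IsInverseChain f₁ f₂ a C → IsAlternating C
    chain⇒alternating {a} {C} a-nc chain = record
      { start∈S   = start-nc
      ; even-len  = even-len
      ; alternate = λ i → alternate i (walk-nc (inject₁ i))
      }
      where
      open IsInverseChain chain
      open IsChain isChain
      start-nc : NonConstant (walk C zero)
      start-nc = subst NonConstant (sym start) a-nc
      alternate : ∀ i → NonConstant (walk C (inject₁ i)) →
                  walk C (suc i) ≡ step (toℕ i) (walk C (inject₁ i))
      alternate i nc with 2 ∣? suc (toℕ i)
      ... | yes 2∣ = trans (I₂.IsInverse⇒≡inv nc (even i 2∣)) (sym (step-odd _ 2∣))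
      ... | no  2∤ = trans (I₁.IsInverse⇒≡inv nc (odd i 2∤)) (sym (step-even _ 2∤))
      walk-nc : ∀ j → NonConstant (walk C j)
      walk-nc = <-weakInduction (NonConstant ∘ walk C) start-nc λ i nc →
        subst NonConstant (sym (alternate i nc)) (step-closed (toℕ i) nc)

    alternating⇒chain : ∀ {C} → IsAlternating C → IsInverseChain f₁ f₂ (walk C zero) C
    alternating⇒chain {C} alt = record
      { even-len = even-len
      ; isChain  = record
        { start = refl
        ; odd   = λ i 2∤ → subst (IsInverse f₁ (walk C (inject₁ i)))
            (sym (trans (alternate i) (step-even _ 2∤))) (I₁.inv-isInverse (walk∈S (inject₁ i)))
        ; even  = λ i 2∣ → subst (IsInverse f₂ (walk C (inject₁ i)))
            (sym (trans (alternate i) (step-odd _ 2∣))) (I₂.inv-isInverse (walk∈S (inject₁ i)))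
        }
      }
      where open IsAlternating alt

    -- A vector is coded by the base p number with its entries as digits.
    open Finite nonConstant? {p ℕ.^ n} (tabulate ∘ finToFun) (funToFin ∘ Vec.lookup)
      (λ v → trans (tabulate-cong (finToFun-funToFin (Vec.lookup v))) (tabulate∘lookup v))
      (≡-dec Finₚ._≟_)

    inducedPartition : ∃ λ Cs → IsInducedPartition f₁ f₂ Cs × All EvenLength≥4 Cs
    inducedPartition with Cs , alts , isPartition ← partition = Cs , record
      { isPartition = isPartition
      ; hasChain    = hasChain
      ; traverses   = λ a a-nc C chain i a∈Cᵢ → common-vertex⇒≅
          (chain⇒alternating a-nc chain) (All.lookup alts (∈-lookup i))
          (subst (_∈ᵛ C) (IsChain.start (IsInverseChain.isChain chain)) (walk∈ᵛ C zero)) a∈Cᵢ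
      } , All.map alternating⇒EvenLength≥4 alts
      where
      hasChain : ∀ a → NonConstant a → ∃ λ C → IsInverseChain f₁ f₂ a C
      hasChain a a-nc with C , alt , refl ← cycle-through a-nc = C , alternating⇒chain alt

corollary2 : (p : ℕ) .{{_ : NonZero p}} → Prime p →
    let open InverseChaining p in
    (n : ℕ) → 0 < n →
    (f₁ f₂ : Poly) →
    MonicOfDegree n f₁ → Irreducible f₁ →
    MonicOfDegree n f₂ → Irreducible f₂ →
    ¬ (f₁ ≈ f₂) →
    ∃ λ (Cs : List (Cycle (𝒫 n))) →
    IsInducedPartition f₁ f₂ Cs
    × All EvenLength≥4 Cs
    × (∀ (Ds : List (Cycle (𝒫 n))) → IsInducedPartition f₁ f₂ Ds → Ds ≋ Cs)
corollary2 p p-prime n 0<n f₁ f₂ f₁-monic f₁-irr f₂-monic f₂-irr f₁≉f₂ =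
  let Cs , induced , lengths = inducedPartition
  in Cs , induced , lengths , λ Ds induced′ C →
       mk⇔ (induced-⊆ induced induced′) (induced-⊆ induced′ induced)
  where
  open PrimeChaining p p-prime
  open Pair 0<n f₁-monic f₁-irr f₂-monic f₂-irr f₁≉f₂
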